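{- For a positive integer $n$, an even integer $z$ and an integer $x$, let $$f_n(x\mid z)=\binom{n}{\frac{n-x}{2}}\binom{n}{\frac{n-z+x}{2}}\bigg/\binom{2n}{n-\frac z2},\qquad \psi_n(x\mid z)=2^{ -n}\binom{n}{\frac{n-x+2\lceil z/4\rceil}{2}},$$ where a binomial coefficient $\binom{n}{j}$ is taken to be $0$ unless $j$ is an integer with $0\le j\le n$. Then for every constant $c>0$, $$\lim_{n\to\infty}\ \sup_{z}\ \left|\ \max_{x}\ \frac{f_n(x\mid z)}{\psi_n(x\mid z)}-\sqrt2\ \right|=0,$$ where the supremum is over even integers $z$ with $|z|\le c\sqrt n$ and the maximum is over integers $x$ with $|x|\le c\sqrt n$ and $x\equiv n \pmod 2$.
   Context: Here $f_n(\cdot\mid z)$ is the conditional probability mass function of $L$ given $S=z$ when $L$ and $S-L$ are independent $n$-step simple random walks (sums of $n$ i.i.d. uniform $\pm1$ variables), and $\psi_n(\cdot\mid z)$ is the probability mass function of $Y'+2\lceil z/4\rceil$ where $Y'$ is an $n$-step simple random walk. In words, the result states that the maximal ratio $f_n(x\mid z)/\psi_n(x\mid z)$ over $x=O(\sqrt n)$ converges to $\sqrt2$ as $n\to\infty$, for $z=O(\sqrt n)$.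
   Formalization: The constant c is taken to be a positive rational number instead of an arbitrary positive real; the limit is stated in its equivalent epsilon–N form with rational epsilon. -}

module Defs where

open import Data.Nat as ℕ using (ℕ; zero; suc)
open import Data.Nat.Combinatorics using (_C_)
open import Data.Integer as ℤ using (ℤ; +_; -[1+_]; _/ℕ_; _%ℕ_)
open import Data.Rational as ℚ using (ℚ; 0ℚ; _÷_; ≢-nonZero)
open import Data.Rational.Properties as ℚP using ()
open import Data.Nat.Properties as ℕP using ()
open import Data.List using (List; map; upTo; filter; foldr)
open import Data.Product using (_×_)
open import Data.Sum using (_⊎_)
open import Relation.Nullary using (yes; no)
open import Relation.Nullary.Decidable using (_×-dec_)

-- Binomial coefficient  C(n, m/2), taken to be 0 unless m/2 is an integer
-- with 0 ≤ m/2 ≤ n  (stdlib's  n C k  is already 0 for k > n).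
binomHalf : ℕ → ℤ → ℕ
binomHalf n (+ k) with k ℕ.% 2
... | zero  = n C (k ℕ./ 2)
... | suc _ = 0
binomHalf n -[1+ _ ] = 0

-- ⌈ z / 4 ⌉  (ℤ._/ℕ_ is floor division)
ceil4 : ℤ → ℤ
ceil4 z = ℤ.- ((ℤ.- z) /ℕ 4)

-- f_n(x | z) = C(n,(n-x)/2) C(n,(n-z+x)/2) / C(2n,n - z/2)
--   (the bottom index n - z/2 = (2n - z)/2).
-- Convention: the value 0 if the denominator vanishes (irrelevant in the regime of the theorem).
f : ℕ → ℤ → ℤ → ℚ
f n z x with binomHalf (2 ℕ.* n) (+ (2 ℕ.* n) ℤ.- z)
... | zero  = 0ℚ
... | suc d = + (binomHalf n (+ n ℤ.- x) ℕ.* binomHalf n (+ n ℤ.- z ℤ.+ x)) ℚ./ suc d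

ψ : ℕ → ℤ → ℤ → ℚ
ψ n z x = + binomHalf n (+ n ℤ.- x ℤ.+ + 2 ℤ.* ceil4 z) ℚ./ (2 ℕ.^ n)
  where instance _ = ℕP.m^n≢0 2 n

-- f_n(x|z) / ψ_n(x|z)   (value 0 by convention when ψ_n(x|z) = 0,
-- which does not happen in the regime of the theorem)
ratio : ℕ → ℤ → ℤ → ℚ
ratio n z x with ψ n z x ℚP.≟ 0ℚ
... | yes _ = 0ℚ
... | no ne = _÷_ (f n z x) (ψ n z x) {{≢-nonZero ne}}

toℚ : ℤ → ℚ
toℚ x = x ℚ./ 1

-- |x| ≤ c √n  (with c ≥ 0), written without square roots as  x² ≤ c² n
InRange : ℚ → ℕ → ℤ → Set
InRange c n x = toℚ (x ℤ.* x) ℚ.≤ c ℚ.* c ℚ.* toℚ (+ n)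

SameParity : ℕ → ℤ → Set
SameParity n x = (+ n ℤ.- x) %ℕ 2 ≡ 0
  where open import Relation.Binary.PropositionalEquality using (_≡_)

intsUpTo : ℕ → List ℤ
intsUpTo B = map (λ i → + i ℤ.- + B) (upTo (suc (2 ℕ.* B)))

-- the admissible x: integers with |x| ≤ c√n and x ≡ n (mod 2).
-- For c > 0 and n ≥ 1 they all satisfy |x| ≤ c√n ≤ ⌈c⌉ n, so the search window
-- [-(|⌈c⌉| n), |⌈c⌉| n] contains all of them.
admissible : ℚ → ℕ → List ℤ
admissible c n = filter (λ x → (toℚ (x ℤ.* x) ℚP.≤? c ℚ.* c ℚ.* toℚ (+ n))
                               ×-dec ((+ n ℤ.- x) %ℕ 2 ℕ.≟ 0))
                        (intsUpTo (ℤ.∣ ℚ.⌈ c ⌉ ∣ ℕ.* n))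

-- max_x f_n(x|z)/ψ_n(x|z) over admissible x (all ratios are ≥ 0, the fold
-- starts at 0; the admissible set is nonempty for n ≥ 1/c²).
maxRatio : ℚ → ℕ → ℤ → ℚ
maxRatio c n z = foldr (λ x m → ratio n z x ℚ.⊔ m) 0ℚ (admissible c n)

-- | q - √2 | < ε  for ε > 0, written without square roots:
--   q < √2 + ε  ⇔  q - ε < 0  or  (q - ε)² < 2
--   q > √2 - ε  ⇔  q + ε > 0  and (q + ε)² > 2
CloseToSqrt2 : ℚ → ℚ → Set
CloseToSqrt2 q ε =
  ((q ℚ.- ε ℚ.< 0ℚ) ⊎ ((q ℚ.- ε) ℚ.* (q ℚ.- ε) ℚ.< toℚ (+ 2)))
  × (0ℚ ℚ.< q ℚ.+ ε × toℚ (+ 2) ℚ.< (q ℚ.+ ε) ℚ.* (q ℚ.+ ε))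

{-# OPTIONS --safe #-}

-- Write z = ±2w with w ≥ 0.  Every nonzero ratio has the form
--   2ⁿ C(n,a) C(n,a+w) / (C(2n,n+w) C(n,a+⌈w/2⌉)).
-- The move (a+1, w) → (a, w+2) keeps a+⌊w/2⌋ and a+⌈w/2⌉ and multiplies the ratio by an explicit
-- rational function.  That factor is at most (n+w+2)(n-w)/((n+w)(n-w-2)), a telescoping bound, for
-- every a, and is at least 1 when a and n-w-a differ by at most 1.  Descending to w ∈ {0, 1} bounds
-- the ratio above by (n+w)/(n-w) · 2ⁿ C(n,p)/C(2n,n) with p = a+⌊w/2⌋, and, for a suitable central
-- a, below by 2ⁿ C(n,⌊n/2⌋)/C(2n,n).
-- With bₖ = C(2k,k), the sequence k bₖ²/16ᵏ increases and (2k+1) bₖ²/16ᵏ decreases.  Comparing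
-- k = ⌈n/2⌉ with n puts (2ⁿ C(n,⌊n/2⌋)/C(2n,n))² between (2n+1)/(n+2) and 2, so neither
-- Stirling's formula nor the value of Wallis' product is needed.
module Submission where

-- The constant comes from a rate of decay alone: bₖ²/16ᵏ behaves like 1/(πk), so its values at
-- ⌈n/2⌉ and at n differ by a factor tending to 2, and π cancels. Thus √2 is met only through its
-- square, and the estimates are squared, cleared of denominators and proved in ℕ. The obstacle is
-- the rounding in ⌈z/4⌉. A step of 2 in w is a step of 4 in z, which moves ⌈z/4⌉ by exactly one and
-- never meets the rounding; what remains of it is confined to w ∈ {0, 1}. The two directions are
-- asymmetric. The upper bound has to cover every x, so its step factor comes from an inequality of
-- AM-GM type, and its telescoped error (n+w)/(n-w) is harmless because w has order √n. The lower
-- bound needs one x for each z, taken next to z/2, the mean of the conditional law; there the AM-GM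
-- step is almost an equality and C(n,p) is central.

module BinomialBounds where

  -- Binomial coefficients over the natural numbers.

  open import Data.Nat
  open import Data.Nat.Properties
  open import Data.Nat.Combinatorics
  open import Data.Nat.Tactic.RingSolver using (solve-∀)
  open import Data.Sum using (_⊎_; inj₁; inj₂)
  open import Relation.Nullary using (yes; no)
  open import Relation.Binary.Definitions using (tri<; tri≈; tri>)
  open import Relation.Binary.PropositionalEquality

  -- The ring solver proves equations only, so a polynomial inequality is certified by its explicit
  -- nonnegative difference `s`.
  slack : ∀ {a b} s → a + s ≡ b → a ≤ b
  slack {a} s eq = subst (a ≤_) eq (m≤m+n a s)

  square-mono-≤ : ∀ {a b} → a ≤ b → a * a ≤ b * b
  square-mono-≤ p = *-mono-≤ p p

  ⌈n/2⌉≡⌊n/2⌋⊎1+⌊n/2⌋ : ∀ n → ⌈ n /2⌉ ≡ ⌊ n /2⌋ ⊎ ⌈ n /2⌉ ≡ suc ⌊ n /2⌋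
  ⌈n/2⌉≡⌊n/2⌋⊎1+⌊n/2⌋ zero          = inj₁ refl
  ⌈n/2⌉≡⌊n/2⌋⊎1+⌊n/2⌋ (suc zero)    = inj₂ refl
  ⌈n/2⌉≡⌊n/2⌋⊎1+⌊n/2⌋ (suc (suc n)) with ⌈n/2⌉≡⌊n/2⌋⊎1+⌊n/2⌋ n
  ... | inj₁ e = inj₁ (cong suc e)
  ... | inj₂ e = inj₂ (cong suc e)

  ⌈n/2⌉≤1+⌊n/2⌋ : ∀ n → ⌈ n /2⌉ ≤ suc ⌊ n /2⌋
  ⌈n/2⌉≤1+⌊n/2⌋ n with ⌈n/2⌉≡⌊n/2⌋⊎1+⌊n/2⌋ n
  ... | inj₁ e = m≤n⇒m≤1+n (≤-reflexive e)
  ... | inj₂ e = ≤-reflexive e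

  n≤⌈n/2⌉+⌈n/2⌉ : ∀ n → n ≤ ⌈ n /2⌉ + ⌈ n /2⌉
  n≤⌈n/2⌉+⌈n/2⌉ n = ≤-trans (≤-reflexive (sym (⌊n/2⌋+⌈n/2⌉≡n n))) (+-monoˡ-≤ ⌈ n /2⌉ (⌊n/2⌋≤⌈n/2⌉ n))

  absorption : ∀ n k → suc k * (suc n C suc k) ≡ suc n * (n C k)
  absorption zero    zero    = refl
  absorption zero    (suc k) = *-zeroʳ k
  absorption (suc n) zero    = trans (*-identityˡ _) (trans (nC1≡n (2 + n)) (sym (*-identityʳ (2 + n))))
  absorption (suc n) (suc k) = begin
    (2 + k) * ((2 + n) C (2 + k))
      ≡⟨ cong ((2 + k) *_) (nCk+nC[k+1]≡[n+1]C[k+1] (suc n) (suc k)) ⟨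
    (2 + k) * (X + Y)
      ≡⟨ regroup k X Y ⟩
    suc k * X + X + (2 + k) * Y
      ≡⟨ cong₂ (λ u v → u + X + v) (absorption n k) (absorption n (suc k)) ⟩
    suc n * (n C k) + X + suc n * (n C suc k)
      ≡⟨ collect (suc n) (n C k) (n C suc k) X ⟩
    X + suc n * (n C k + n C suc k)
      ≡⟨ cong (λ u → X + suc n * u) (nCk+nC[k+1]≡[n+1]C[k+1] n k) ⟩
    (2 + n) * X ∎
    where
    open ≡-Reasoning
    X = suc n C suc k
    Y = suc n C (2 + k)
    regroup : ∀ k X Y → (2 + k) * (X + Y) ≡ suc k * X + X + (2 + k) * Y
    regroup = solve-∀
    collect : ∀ m u v X → m * u + X + m * v ≡ X + m * (u + v)
    collect = solve-∀

  -- `absorption` and Pascal's rule, after cancelling `suc k * (n C k)`. The complement of `k`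
  -- enters as a summand `j`, which keeps truncated subtraction out of the step formulas.
  binomial-step : ∀ {n k j} → n ≡ k + j → suc k * (n C suc k) ≡ j * (n C k)
  binomial-step {n} {k} {j} refl = +-cancelˡ-≡ (suc k * (n C k)) _ _ (begin
    suc k * (n C k) + suc k * (n C suc k)
      ≡⟨ *-distribˡ-+ (suc k) (n C k) (n C suc k) ⟨
    suc k * (n C k + n C suc k)
      ≡⟨ cong (suc k *_) (nCk+nC[k+1]≡[n+1]C[k+1] n k) ⟩
    suc k * (suc n C suc k)
      ≡⟨ absorption n k ⟩
    suc n * (n C k)
      ≡⟨ *-distribʳ-+ (n C k) (suc k) j ⟩
    suc k * (n C k) + j * (n C k) ∎)
    where open ≡-Reasoning

  k≤n⇒nCk>0 : ∀ {n k} → k ≤ n → 0 < n C k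
  k≤n⇒nCk>0 {n}     {zero}  _         = ≤-refl
  k≤n⇒nCk>0 {suc n} {suc k} (s≤s k≤n) =
    ≤-trans (k≤n⇒nCk>0 k≤n)
      (≤-trans (m≤m+n (n C k) (n C suc k)) (≤-reflexive (nCk+nC[k+1]≡[n+1]C[k+1] n k)))

  -- The quotient of consecutive entries at index i is (n - i)/(i + 1), which is at most 1 once n ≤
  -- 2i; past `n` the entries vanish.
  nC[k+j]≤nCk : ∀ n k j → n ≤ k + k → n C (k + j) ≤ n C k
  nC[k+j]≤nCk n k zero    _    = ≤-reflexive (cong (n C_) (+-identityʳ k))
  nC[k+j]≤nCk n k (suc j) n≤2k with k + j ≤? n
  ... | no ¬p = ≤-trans (≤-reflexive (k>n⇒nCk≡0 (<-trans (≰⇒> ¬p) (+-monoʳ-< k (n<1+n j))))) z≤n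
  ... | yes p = ≤-trans lem (nC[k+j]≤nCk n k j n≤2k)
    where
    r = n ∸ (k + j)
    n≡ : n ≡ k + j + r
    n≡ = sym (m+[n∸m]≡n p)
    r≤k+j : r ≤ suc (k + j)
    r≤k+j = +-cancelˡ-≤ (k + j) r _ (begin
      k + j + r             ≡⟨ n≡ ⟨
      n                     ≤⟨ n≤2k ⟩
      k + k                 ≤⟨ +-mono-≤ (m≤m+n k j) (m≤n⇒m≤1+n (m≤m+n k j)) ⟩
      k + j + suc (k + j)   ∎)
      where open ≤-Reasoning
    lem : n C (k + suc j) ≤ n C (k + j)
    lem rewrite +-suc k j = *-cancelˡ-≤ (suc (k + j)) (begin
      suc (k + j) * (n C suc (k + j))  ≡⟨ binomial-step n≡ ⟩
      r * (n C (k + j))                ≤⟨ *-monoˡ-≤ (n C (k + j)) r≤k+j ⟩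
      suc (k + j) * (n C (k + j))      ∎)
      where open ≤-Reasoning

  nC⌊n/2⌋≡nC⌈n/2⌉ : ∀ n → n C ⌊ n /2⌋ ≡ n C ⌈ n /2⌉
  nC⌊n/2⌋≡nC⌈n/2⌉ n = trans (nCk≡nC[n∸k] (⌊n/2⌋≤n n)) (cong (n C_) (begin
    n ∸ ⌊ n /2⌋                         ≡⟨ cong (_∸ ⌊ n /2⌋) (⌊n/2⌋+⌈n/2⌉≡n n) ⟨
    ⌊ n /2⌋ + ⌈ n /2⌉ ∸ ⌊ n /2⌋         ≡⟨ m+n∸m≡n ⌊ n /2⌋ ⌈ n /2⌉ ⟩
    ⌈ n /2⌉                             ∎))
    where open ≡-Reasoning

  -- From ⌈n/2⌉ on the row decreases; an index below it is first reflected to `n ∸ p`.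
  nCk≤nC⌈n/2⌉ : ∀ n p → n C p ≤ n C ⌈ n /2⌉
  nCk≤nC⌈n/2⌉ n p with ⌈ n /2⌉ ≤? p | p ≤? n
  ... | yes k≤p | _ = subst (λ i → n C i ≤ n C ⌈ n /2⌉) (m+[n∸m]≡n k≤p)
          (nC[k+j]≤nCk n ⌈ n /2⌉ (p ∸ ⌈ n /2⌉) (n≤⌈n/2⌉+⌈n/2⌉ n))
  ... | no ¬k≤p | no ¬p≤n = ≤-trans (≤-reflexive (k>n⇒nCk≡0 (≰⇒> ¬p≤n))) z≤n
  ... | no ¬k≤p | yes p≤n =
    ≤-trans (≤-reflexive (nCk≡nC[n∸k] p≤n))
      (subst (λ i → n C i ≤ n C ⌈ n /2⌉) (m+[n∸m]≡n k≤n∸p)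
        (nC[k+j]≤nCk n ⌈ n /2⌉ (n ∸ p ∸ ⌈ n /2⌉) (n≤⌈n/2⌉+⌈n/2⌉ n)))
    where
    p≤⌊n/2⌋ : p ≤ ⌊ n /2⌋
    p≤⌊n/2⌋ = s≤s⁻¹ (≤-trans (≰⇒> ¬k≤p) (⌈n/2⌉≤1+⌊n/2⌋ n))
    k≤n∸p : ⌈ n /2⌉ ≤ n ∸ p
    k≤n∸p = m+n≤o⇒m≤o∸n ⌈ n /2⌉ (≤-trans (+-monoʳ-≤ ⌈ n /2⌉ p≤⌊n/2⌋)
      (≤-reflexive (trans (+-comm ⌈ n /2⌉ ⌊ n /2⌋) (⌊n/2⌋+⌈n/2⌉≡n n))))

  -- Central binomial coefficients and the factor 2.

  centralBinomial : ℕ → ℕ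
  centralBinomial k = (2 * k) C k

  -- Pascal's rule yields the two middle entries of row 2k + 1, which are equal by symmetry. This is
  -- the access to odd rows.
  centralBinomial-half : ∀ k → centralBinomial (suc k) ≡ 2 * ((2 * k + 1) C k)
  centralBinomial-half k = begin
    (2 * suc k) C suc k                      ≡⟨ cong (_C suc k) (idx k) ⟩
    suc (2 * k + 1) C suc k                  ≡⟨ nCk+nC[k+1]≡[n+1]C[k+1] (2 * k + 1) k ⟨
    (2 * k + 1) C k + (2 * k + 1) C suc k    ≡⟨ cong ((2 * k + 1) C k +_) sym-eq ⟨
    (2 * k + 1) C k + (2 * k + 1) C k        ≡⟨ cong ((2 * k + 1) C k +_) (sym (+-identityʳ _)) ⟩
    2 * ((2 * k + 1) C k)                    ∎
    where
    open ≡-Reasoning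
    idx : ∀ k → 2 * suc k ≡ suc (2 * k + 1)
    idx = solve-∀
    split : ∀ k → 2 * k + 1 ≡ k + suc k
    split = solve-∀
    sym-eq : (2 * k + 1) C k ≡ (2 * k + 1) C suc k
    sym-eq = trans (nCk≡nC[n∸k] (≤-trans (m≤m+n k (suc k)) (≤-reflexive (sym (split k)))))
      (cong ((2 * k + 1) C_) (trans (cong (_∸ k) (split k)) (m+n∸m≡n k (suc k))))

  centralBinomial-step : ∀ k → suc k * centralBinomial (suc k) ≡ 2 * (2 * k + 1) * centralBinomial k
  centralBinomial-step k = begin
    suc k * centralBinomial (suc k)          ≡⟨ cong (suc k *_) (centralBinomial-half k) ⟩
    suc k * (2 * Y)                          ≡⟨ shuffle (suc k) Y ⟩
    2 * (suc k * Y)                          ≡⟨ cong (2 *_) (binomial-step (split k)) ⟨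
    2 * (suc k * ((2 * k + 1) C suc k))      ≡⟨ cong (λ m → 2 * (suc k * (m C suc k))) (+-comm (2 * k) 1) ⟩
    2 * (suc k * (suc (2 * k) C suc k))      ≡⟨ cong (2 *_) (absorption (2 * k) k) ⟩
    2 * (suc (2 * k) * centralBinomial k)    ≡⟨ reassoc k (centralBinomial k) ⟩
    2 * (2 * k + 1) * centralBinomial k      ∎
    where
    open ≡-Reasoning
    Y = (2 * k + 1) C k
    split : ∀ k → 2 * k + 1 ≡ k + suc k
    split = solve-∀
    shuffle : ∀ s y → s * (2 * y) ≡ 2 * (s * y)
    shuffle = solve-∀
    reassoc : ∀ k y → 2 * (suc (2 * k) * y) ≡ 2 * (2 * k + 1) * y
    reassoc = solve-∀

  -- By `centralBinomial-step`, one step reduces to 16m(m + 1) ≤ 4(2m + 1)², where the gap is 4.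
  k·central²-mono : ∀ k j → k * (centralBinomial k * centralBinomial k) * 16 ^ j
    ≤ (k + j) * (centralBinomial (k + j) * centralBinomial (k + j))
  k·central²-mono k zero    = ≤-reflexive (trans (*-identityʳ _)
    (cong (λ m → m * (centralBinomial m * centralBinomial m)) (sym (+-identityʳ k))))
  k·central²-mono k (suc j) rewrite +-suc k j = begin
    k * (b k * b k) * (16 * 16 ^ j)          ≡⟨ out (k * (b k * b k)) (16 ^ j) ⟩
    16 * (k * (b k * b k) * 16 ^ j)          ≤⟨ *-monoʳ-≤ 16 (k·central²-mono k j) ⟩
    16 * (m * (b m * b m))                   ≤⟨ *-cancelˡ-≤ (suc m) step ⟩
    suc m * (b (suc m) * b (suc m))          ∎
    where
    open ≤-Reasoning
    b = centralBinomial
    m = k + j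
    out : ∀ x y → x * (16 * y) ≡ 16 * (x * y)
    out = solve-∀
    expand : ∀ m b → suc m * (16 * (m * (b * b))) + 4 * (b * b) ≡ (2 * (2 * m + 1) * b) * (2 * (2 * m + 1) * b)
    expand = solve-∀
    square : ∀ s c → (s * c) * (s * c) ≡ s * (s * (c * c))
    square = solve-∀
    step : suc m * (16 * (m * (b m * b m))) ≤ suc m * (suc m * (b (suc m) * b (suc m)))
    step = begin
      suc m * (16 * (m * (b m * b m)))                 ≤⟨ slack (4 * (b m * b m)) (expand m (b m)) ⟩
      (2 * (2 * m + 1) * b m) * (2 * (2 * m + 1) * b m) ≡⟨ cong (λ x → x * x) (centralBinomial-step m) ⟨
      (suc m * b (suc m)) * (suc m * b (suc m))        ≡⟨ square (suc m) (b (suc m)) ⟩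
      suc m * (suc m * (b (suc m) * b (suc m)))        ∎

  -- By `centralBinomial-step`, one step reduces to (2m + 1)(2m + 3) ≤ 4(m + 1)², where the gap is
  -- 1.
  [2k+1]·central²-anti : ∀ k j → (2 * (k + j) + 1) * (centralBinomial (k + j) * centralBinomial (k + j))
    ≤ (2 * k + 1) * (centralBinomial k * centralBinomial k) * 16 ^ j
  [2k+1]·central²-anti k zero    = ≤-reflexive (trans
    (cong (λ m → (2 * m + 1) * (centralBinomial m * centralBinomial m)) (+-identityʳ k)) (sym (*-identityʳ _)))
  [2k+1]·central²-anti k (suc j) rewrite +-suc k j = begin
    (2 * suc m + 1) * (b (suc m) * b (suc m))            ≤⟨ *-cancelˡ-≤ (suc m * suc m) step ⟩
    16 * ((2 * m + 1) * (b m * b m))                     ≤⟨ *-monoʳ-≤ 16 ([2k+1]·central²-anti k j) ⟩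
    16 * ((2 * k + 1) * (b k * b k) * 16 ^ j)            ≡⟨ out ((2 * k + 1) * (b k * b k)) (16 ^ j) ⟨
    (2 * k + 1) * (b k * b k) * (16 * 16 ^ j)            ∎
    where
    open ≤-Reasoning
    b = centralBinomial
    m = k + j
    out : ∀ x y → x * (16 * y) ≡ 16 * (x * y)
    out = solve-∀
    expand : ∀ m b → (2 * suc m + 1) * ((2 * (2 * m + 1) * b) * (2 * (2 * m + 1) * b)) + 4 * ((2 * m + 1) * (b * b))
           ≡ suc m * suc m * (16 * ((2 * m + 1) * (b * b)))
    expand = solve-∀
    square : ∀ s t c → s * s * (t * (c * c)) ≡ t * ((s * c) * (s * c))
    square = solve-∀
    step : suc m * suc m * ((2 * suc m + 1) * (b (suc m) * b (suc m))) ≤ suc m * suc m * (16 * ((2 * m + 1) * (b m * b m)))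
    step = begin
      suc m * suc m * ((2 * suc m + 1) * (b (suc m) * b (suc m)))
        ≡⟨ square (suc m) (2 * suc m + 1) (b (suc m)) ⟩
      (2 * suc m + 1) * ((suc m * b (suc m)) * (suc m * b (suc m)))
        ≡⟨ cong (λ x → (2 * suc m + 1) * (x * x)) (centralBinomial-step m) ⟩
      (2 * suc m + 1) * ((2 * (2 * m + 1) * b m) * (2 * (2 * m + 1) * b m))
        ≤⟨ slack _ (expand m (b m)) ⟩
      suc m * suc m * (16 * ((2 * m + 1) * (b m * b m))) ∎

  -- Both parities of `n` are reduced to a central binomial at the rounded-up half. For n = 2f + 1
  -- that binomial is twice the middle entry of row n, and the resulting 4 is exactly what `16 ^ f`
  -- lacks compared with 4ⁿ.
  central-identity : ∀ n → centralBinomial ⌈ n /2⌉ * centralBinomial ⌈ n /2⌉ * 16 ^ ⌊ n /2⌋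
    ≡ 2 ^ n * 2 ^ n * ((n C ⌊ n /2⌋) * (n C ⌊ n /2⌋))
  central-identity n = by-parity n ⌊ n /2⌋ ⌈ n /2⌉ (⌊n/2⌋+⌈n/2⌉≡n n) (⌈n/2⌉≡⌊n/2⌋⊎1+⌊n/2⌋ n)
    where
    open ≡-Reasoning
    b = centralBinomial
    16^ : ∀ f → 16 ^ f ≡ 2 ^ (f + f) * 2 ^ (f + f)
    16^ f = begin
      16 ^ f                     ≡⟨ ^-*-assoc 2 4 f ⟩
      2 ^ (4 * f)                ≡⟨ cong (2 ^_) (quadruple f) ⟩
      2 ^ ((f + f) + (f + f))    ≡⟨ ^-distribˡ-+-* 2 (f + f) (f + f) ⟩
      2 ^ (f + f) * 2 ^ (f + f)  ∎
      where
      quadruple : ∀ f → 4 * f ≡ (f + f) + (f + f)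
      quadruple = solve-∀
    by-parity : ∀ n f k → f + k ≡ n → k ≡ f ⊎ k ≡ suc f →
      b k * b k * 16 ^ f ≡ 2 ^ n * 2 ^ n * ((n C f) * (n C f))
    by-parity n f k refl (inj₁ refl) = begin
      b f * b f * 16 ^ f
        ≡⟨ cong₂ (λ m e → (m C f) * (m C f) * e) (cong (f +_) (+-identityʳ f)) (16^ f) ⟩
      Y * Y * (2 ^ (f + f) * 2 ^ (f + f))
        ≡⟨ *-comm (Y * Y) _ ⟩
      2 ^ (f + f) * 2 ^ (f + f) * (Y * Y) ∎
      where Y = (f + f) C f
    by-parity n f k refl (inj₂ refl) = begin
      b (suc f) * b (suc f) * 16 ^ f
        ≡⟨ cong₂ (λ y e → y * y * e) (trans (centralBinomial-half f) (cong (λ m → 2 * (m C f)) (idx f))) (16^ f) ⟩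
      2 * Y * (2 * Y) * (2 ^ (f + f) * 2 ^ (f + f))
        ≡⟨ regroup Y (2 ^ (f + f)) ⟩
      2 ^ suc (f + f) * 2 ^ suc (f + f) * (Y * Y)
        ≡⟨ cong (λ m → 2 ^ m * 2 ^ m * (Y * Y)) (+-suc f f) ⟨
      2 ^ (f + suc f) * 2 ^ (f + suc f) * (Y * Y) ∎
      where
      Y = (f + suc f) C f
      idx : ∀ f → 2 * f + 1 ≡ f + suc f
      idx = solve-∀
      regroup : ∀ y e → 2 * y * (2 * y) * (e * e) ≡ (2 * e) * (2 * e) * (y * y)
      regroup = solve-∀

  -- Monotonicity from k = ⌈n/2⌉ to n gives the quotient n/k, and n ≤ 2k makes it at most 2.
  central-upper : ∀ n p → 1 ≤ n →
    2 ^ n * 2 ^ n * ((n C p) * (n C p)) ≤ 2 * (centralBinomial n * centralBinomial n)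
  central-upper n p 1≤n = begin
    2 ^ n * 2 ^ n * ((n C p) * (n C p))
      ≤⟨ *-monoʳ-≤ (2 ^ n * 2 ^ n) (square-mono-≤ (≤-trans (nCk≤nC⌈n/2⌉ n p) (≤-reflexive (sym (nC⌊n/2⌋≡nC⌈n/2⌉ n))))) ⟩
    2 ^ n * 2 ^ n * ((n C f) * (n C f))
      ≡⟨ central-identity n ⟨
    b k * b k * 16 ^ f
      ≤⟨ *-cancelˡ-≤ k {{>-nonZero 1≤k}} scaled ⟩
    2 * (b n * b n) ∎
    where
    open ≤-Reasoning
    b = centralBinomial
    f = ⌊ n /2⌋
    k = ⌈ n /2⌉
    1≤k : 1 ≤ k
    1≤k = ⌈n/2⌉-mono 1≤n
    k+f≡n : k + f ≡ n
    k+f≡n = trans (+-comm k f) (⌊n/2⌋+⌈n/2⌉≡n n)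
    double : ∀ k y → (k + k) * y ≡ k * (2 * y)
    double = solve-∀
    scaled : k * (b k * b k * 16 ^ f) ≤ k * (2 * (b n * b n))
    scaled = begin
      k * (b k * b k * 16 ^ f)                ≡⟨ *-assoc k (b k * b k) (16 ^ f) ⟨
      k * (b k * b k) * 16 ^ f                ≤⟨ k·central²-mono k f ⟩
      (k + f) * (b (k + f) * b (k + f))       ≡⟨ cong (λ m → (k + f) * (b m * b m)) k+f≡n ⟩
      (k + f) * (b n * b n)                   ≤⟨ *-monoˡ-≤ (b n * b n) (+-monoʳ-≤ k (⌊n/2⌋≤⌈n/2⌉ n)) ⟩
      (k + k) * (b n * b n)                   ≡⟨ double k (b n * b n) ⟩
      k * (2 * (b n * b n))                   ∎

  -- The decreasing sequence gives the quotient (2n + 1)/(2k + 1) at k = ⌈n/2⌉, where 2k + 1 ≤ n +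
  -- 2.
  central-lower : ∀ n → (2 * n + 1) * (centralBinomial n * centralBinomial n)
    ≤ (n + 2) * (2 ^ n * 2 ^ n * ((n C ⌊ n /2⌋) * (n C ⌊ n /2⌋)))
  central-lower n = begin
    (2 * n + 1) * (b n * b n)                 ≡⟨ cong (λ m → (2 * m + 1) * (b m * b m)) k+f≡n ⟨
    (2 * (k + f) + 1) * (b (k + f) * b (k + f)) ≤⟨ [2k+1]·central²-anti k f ⟩
    (2 * k + 1) * (b k * b k) * 16 ^ f        ≡⟨ *-assoc (2 * k + 1) (b k * b k) (16 ^ f) ⟩
    (2 * k + 1) * (b k * b k * 16 ^ f)        ≤⟨ *-monoˡ-≤ (b k * b k * 16 ^ f) 2k+1≤n+2 ⟩
    (n + 2) * (b k * b k * 16 ^ f)            ≡⟨ cong ((n + 2) *_) (central-identity n) ⟩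
    (n + 2) * (2 ^ n * 2 ^ n * ((n C f) * (n C f))) ∎
    where
    open ≤-Reasoning
    b = centralBinomial
    f = ⌊ n /2⌋
    k = ⌈ n /2⌉
    k+f≡n : k + f ≡ n
    k+f≡n = trans (+-comm k f) (⌊n/2⌋+⌈n/2⌉≡n n)
    left : ∀ k → 2 * k + 1 ≡ k + (k + 1)
    left = solve-∀
    right : ∀ k f → k + (suc f + 1) ≡ k + f + 2
    right = solve-∀
    2k+1≤n+2 : 2 * k + 1 ≤ n + 2
    2k+1≤n+2 = begin
      2 * k + 1          ≡⟨ left k ⟩
      k + (k + 1)        ≤⟨ +-monoʳ-≤ k (+-monoˡ-≤ 1 (⌈n/2⌉≤1+⌊n/2⌋ n)) ⟩
      k + (suc f + 1)    ≡⟨ right k f ⟩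
      k + f + 2          ≡⟨ cong (_+ 2) k+f≡n ⟩
      n + 2              ∎

  -- Passing from (a + 1 , w) to (a , w + 2) leaves n, a + ⌊w/2⌋ and a + ⌈w/2⌉ unchanged, so only
  -- the two numerator binomials x, y and the denominator binomial D move.
  module Step (a b w : ℕ) where
    -- With `b` the complement of a + (w + 2) in `n`, all factors are free of subtraction: `A + B`
    -- is n - w, `a + b` is n - w - 2, `a + b + 2 * W` is n + w, `a + b + 1 + 2 * W` is n + w + 1,
    -- and `A + B + 2 * W` is n + w + 2.
    n = a + b + w + 2
    A = suc a
    B = suc b
    W = suc w
    x₀ = n C a
    x₁ = n C suc a
    y₁ = n C suc (a + w)
    y₂ = n C suc (suc (a + w))
    D₀ = (2 * n) C (n + w)
    D₁ = (2 * n) C suc (n + w)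
    D₂ = (2 * n) C suc (suc (n + w))

    x-step : A * x₁ ≡ (B + W) * x₀
    x-step = binomial-step {n} (idx a b w)
      where
      idx : ∀ a b w → a + b + w + 2 ≡ a + (suc b + suc w)
      idx = solve-∀

    y-step : (A + W) * y₂ ≡ B * y₁
    y-step = trans (cong (_* y₂) (idx′ a w)) (binomial-step {n} (idx a b w))
      where
      idx : ∀ a b w → a + b + w + 2 ≡ suc (a + w) + suc b
      idx = solve-∀
      idx′ : ∀ a w → suc a + suc w ≡ suc (suc (a + w))
      idx′ = solve-∀

    D-step : (A + B + 2 * W) * (a + b + 1 + 2 * W) * D₂ ≡ (A + B) * (a + b + 1) * D₀
    D-step = begin
      (A + B + 2 * W) * (a + b + 1 + 2 * W) * D₂  ≡⟨ cong₂ (λ u v → u * v * D₂) (idx₁ a b w) (idx₂ a b w) ⟩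
      suc (suc (n + w)) * suc (n + w) * D₂        ≡⟨ swap (suc (suc (n + w))) (suc (n + w)) D₂ ⟩
      suc (n + w) * (suc (suc (n + w)) * D₂)      ≡⟨ cong (suc (n + w) *_) (binomial-step {2 * n} (idx₃ a b w)) ⟩
      suc (n + w) * ((a + b + 1) * D₁)            ≡⟨ swap′ (suc (n + w)) (a + b + 1) D₁ ⟩
      (a + b + 1) * (suc (n + w) * D₁)            ≡⟨ cong ((a + b + 1) *_) (binomial-step {2 * n} (idx₄ a b w)) ⟩
      (a + b + 1) * ((A + B) * D₀)                ≡⟨ swap (A + B) (a + b + 1) D₀ ⟨
      (A + B) * (a + b + 1) * D₀                  ∎
      where
      open ≡-Reasoning
      idx₁ : ∀ a b w → suc a + suc b + 2 * suc w ≡ suc (suc (a + b + w + 2 + w))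
      idx₁ = solve-∀
      idx₂ : ∀ a b w → a + b + 1 + 2 * suc w ≡ suc (a + b + w + 2 + w)
      idx₂ = solve-∀
      idx₃ : ∀ a b w → 2 * (a + b + w + 2) ≡ suc (a + b + w + 2 + w) + (a + b + 1)
      idx₃ = solve-∀
      idx₄ : ∀ a b w → 2 * (a + b + w + 2) ≡ (a + b + w + 2 + w) + (suc a + suc b)
      idx₄ = solve-∀
      swap : ∀ u v d → u * v * d ≡ v * (u * d)
      swap = solve-∀
      swap′ : ∀ u v d → u * (v * d) ≡ v * (u * d)
      swap′ = solve-∀

    private
      pull : ∀ p q x y → p * q * (x * y) ≡ (p * x) * (q * y)
      pull = solve-∀

    xy-step : (B + W) * (A + W) * (x₀ * y₂) ≡ A * B * (x₁ * y₁)
    xy-step = trans (pull (B + W) (A + W) x₀ y₂)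
      (trans (cong₂ _*_ (sym x-step) y-step) (sym (pull A B x₁ y₁)))

    -- For a fixed sum A + B the quotient AB/((A + W)(B + W)) is largest at A = B. The difference of
    -- the two sides is (W(A + B) + W²)(A - B)².
    am-gm : A * B * ((A + B + 2 * W) * (A + B + 2 * W)) ≤ (B + W) * (A + W) * ((A + B) * (A + B))
    am-gm with ≤-total a b
    ... | inj₁ a≤b rewrite sym (m+[n∸m]≡n a≤b) = slack _ (identity A (b ∸ a) W)
      where
      identity : ∀ A d W → A * (A + d) * ((A + (A + d) + 2 * W) * (A + (A + d) + 2 * W)) + (W * (A + (A + d)) + W * W) * (d * d)
        ≡ (A + d + W) * (A + W) * ((A + (A + d)) * (A + (A + d)))
      identity = solve-∀
    ... | inj₂ b≤a rewrite sym (m+[n∸m]≡n b≤a) = slack _ (identity B (a ∸ b) W)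
      where
      identity : ∀ B d W → (B + d) * B * ((B + d + B + 2 * W) * (B + d + B + 2 * W)) + (W * (B + d + B) + W * W) * (d * d)
        ≡ (B + W) * (B + d + W) * ((B + d + B) * (B + d + B))
      identity = solve-∀

    -- The step multiplies the ratio by AB/((A + W)(B + W)) · (n+w+2)(n+w+1)/((n-w)(n-w-1)).
    -- Bounding the first quotient by `am-gm` and giving up one or two units in the remaining
    -- factors produces the quotient that telescopes.
    upper-factor : A * B * (a + b + 1 + 2 * W) * (a + b) * (a + b + 2 * W)
      ≤ (B + W) * (A + W) * ((A + B) * (A + B)) * (a + b + 1)
    upper-factor = begin
      A * B * (R + 1 + 2 * W) * R * (R + 2 * W)
        ≡⟨ regroup (A * B) (R + 1 + 2 * W) R (R + 2 * W) ⟩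
      A * B * ((R + 1 + 2 * W) * (R + 2 * W)) * R
        ≤⟨ *-mono-≤ (*-monoʳ-≤ (A * B) (*-mono-≤ (slack 1 (V≡ a b W)) (slack 2 (V≡′ a b W)))) (m≤m+n R 1) ⟩
      A * B * ((A + B + 2 * W) * (A + B + 2 * W)) * (R + 1)
        ≤⟨ *-monoˡ-≤ (R + 1) am-gm ⟩
      (B + W) * (A + W) * ((A + B) * (A + B)) * (R + 1) ∎
      where
      open ≤-Reasoning
      R = a + b
      regroup : ∀ p u r v → p * u * r * v ≡ p * (u * v) * r
      regroup = solve-∀
      V≡ : ∀ a b W → a + b + 1 + 2 * W + 1 ≡ suc a + suc b + 2 * W
      V≡ = solve-∀
      V≡′ : ∀ a b W → a + b + 2 * W + 2 ≡ suc a + suc b + 2 * W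
      V≡′ = solve-∀

    -- `K` and `L` stand for what the step leaves alone: C(2n,n) and the product of the two
    -- binomials with fixed index. The weight (n - w)/(n + w) of the induction hypothesis becomes (n
    -- - w - 2)/(n + w + 2).
    upper-step : ∀ K L →
      x₁ * y₁ * (A + B) * K ≤ (a + b + 2 * W) * D₀ * L →
      x₀ * y₂ * (a + b) * K ≤ (A + B + 2 * W) * D₂ * L
    upper-step K L hyp = *-cancelˡ-≤ (F * V′ * S) (begin
      F * V′ * S * (x₀ * y₂ * R * K)            ≡⟨ perm₁ F V′ S (x₀ * y₂) R K ⟩
      F * (x₀ * y₂) * (V′ * S * R * K)          ≡⟨ cong (_* (V′ * S * R * K)) xy-step ⟩
      A * B * (x₁ * y₁) * (V′ * S * R * K)      ≡⟨ perm₂ (A * B) (x₁ * y₁) V′ S R K ⟩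
      A * B * V′ * R * (x₁ * y₁ * S * K)        ≤⟨ *-monoʳ-≤ (A * B * V′ * R) hyp ⟩
      A * B * V′ * R * (V″ * D₀ * L)            ≡⟨ perm₃ (A * B * V′ * R) V″ D₀ L ⟩
      A * B * V′ * R * V″ * (D₀ * L)            ≤⟨ *-monoˡ-≤ (D₀ * L) upper-factor ⟩
      F * (S * S) * (R + 1) * (D₀ * L)          ≡⟨ perm₄ F S (R + 1) D₀ L ⟩
      F * S * L * (S * (R + 1) * D₀)            ≡⟨ cong (F * S * L *_) D-step ⟨
      F * S * L * (V * V′ * D₂)                 ≡⟨ perm₅ F S L V V′ D₂ ⟩
      F * V′ * S * (V * D₂ * L)                 ∎)
      where
      open ≤-Reasoning
      F  = (B + W) * (A + W)
      R  = a + b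
      S  = A + B
      V  = A + B + 2 * W
      V′ = a + b + 1 + 2 * W
      V″ = a + b + 2 * W
      instance
        V′≢0 : NonZero V′
        V′≢0 = subst NonZero (sym (cong (_+ 2 * W) (+-comm (a + b) 1))) _
        FV′≢0 : NonZero (F * V′)
        FV′≢0 = m*n≢0 F V′
        FV′S≢0 : NonZero (F * V′ * S)
        FV′S≢0 = m*n≢0 (F * V′) S
      perm₁ : ∀ F v S x R K → F * v * S * (x * R * K) ≡ F * x * (v * S * R * K)
      perm₁ = solve-∀
      perm₂ : ∀ p x v S R K → p * x * (v * S * R * K) ≡ p * v * R * (x * S * K)
      perm₂ = solve-∀
      perm₃ : ∀ p v D L → p * (v * D * L) ≡ p * v * (D * L)
      perm₃ = solve-∀
      perm₄ : ∀ F S r D L → F * (S * S) * r * (D * L) ≡ F * S * L * (S * r * D)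
      perm₄ = solve-∀
      perm₅ : ∀ F S L V v D → F * S * L * (V * v * D) ≡ F * v * S * (V * D * L)
      perm₅ = solve-∀

    -- Near the equality case `am-gm` loses at most a term with (A - B)² = 1. The quotient
    -- (a+b+1+2W)/(a+b+1) exceeds (A+B+2W)/(A+B) by enough to pay for it: in all three cases the
    -- surplus is 2M(M + W)W with M the smaller of `A` and `B`.
    lower-factor : a ≤ suc b → b ≤ suc a →
      (B + W) * (A + W) * ((A + B) * (a + b + 1)) ≤ A * B * ((A + B + 2 * W) * (a + b + 1 + 2 * W))
    lower-factor a≤1+b b≤1+a with <-cmp a b
    ... | tri≈ _ refl _ = slack _ (identity a W)
      where
      identity : ∀ a W → (suc a + W) * (suc a + W) * ((suc a + suc a) * (a + a + 1)) + 2 * suc a * (suc a + W) * W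
        ≡ suc a * suc a * ((suc a + suc a + 2 * W) * (a + a + 1 + 2 * W))
      identity = solve-∀
    ... | tri< a<b _ _ rewrite ≤-antisym b≤1+a a<b = slack _ (identity a W)
      where
      identity : ∀ a W → (suc (suc a) + W) * (suc a + W) * ((suc a + suc (suc a)) * (a + suc a + 1)) + 2 * suc a * (suc a + W) * W
        ≡ suc a * suc (suc a) * ((suc a + suc (suc a) + 2 * W) * (a + suc a + 1 + 2 * W))
      identity = solve-∀
    ... | tri> _ _ b<a rewrite ≤-antisym a≤1+b b<a = slack _ (identity b W)
      where
      identity : ∀ b W → (suc b + W) * (suc (suc b) + W) * ((suc (suc b) + suc b) * (suc b + b + 1)) + 2 * suc b * (suc b + W) * W
        ≡ suc (suc b) * suc b * ((suc (suc b) + suc b + 2 * W) * (suc b + b + 1 + 2 * W))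
      identity = solve-∀

    lower-step : ∀ K L → a ≤ suc b → b ≤ suc a →
      D₀ * L ≤ x₁ * y₁ * K → D₂ * L ≤ x₀ * y₂ * K
    lower-step K L a≤1+b b≤1+a hyp = *-cancelˡ-≤ (F * (V * V′)) (begin
      F * (V * V′) * (D₂ * L)             ≡⟨ perm₁ F (V * V′) D₂ L ⟩
      F * L * (V * V′ * D₂)               ≡⟨ cong (F * L *_) D-step ⟩
      F * L * (S * (R + 1) * D₀)          ≡⟨ perm₂ F L (S * (R + 1)) D₀ ⟩
      F * (S * (R + 1)) * (D₀ * L)        ≤⟨ *-mono-≤ (lower-factor a≤1+b b≤1+a) hyp ⟩
      A * B * (V * V′) * (x₁ * y₁ * K)    ≡⟨ perm₃ (A * B) (V * V′) (x₁ * y₁) K ⟩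
      A * B * (x₁ * y₁) * (V * V′ * K)    ≡⟨ cong (_* (V * V′ * K)) xy-step ⟨
      F * (x₀ * y₂) * (V * V′ * K)        ≡⟨ perm₃ F (V * V′) (x₀ * y₂) K ⟨
      F * (V * V′) * (x₀ * y₂ * K)        ∎)
      where
      open ≤-Reasoning
      F  = (B + W) * (A + W)
      R  = a + b
      S  = A + B
      V  = A + B + 2 * W
      V′ = a + b + 1 + 2 * W
      instance
        V′≢0 : NonZero V′
        V′≢0 = subst NonZero (sym (cong (_+ 2 * W) (+-comm (a + b) 1))) _
        VV′≢0 : NonZero (V * V′)
        VV′≢0 = m*n≢0 V V′
        FVV′≢0 : NonZero (F * (V * V′))
        FVV′≢0 = m*n≢0 F (V * V′)
      perm₁ : ∀ F v D L → F * v * (D * L) ≡ F * L * (v * D)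
      perm₁ = solve-∀
      perm₂ : ∀ F L s D → F * L * (s * D) ≡ F * s * (D * L)
      perm₂ = solve-∀
      perm₃ : ∀ p v x K → p * v * (x * K) ≡ p * x * (v * K)
      perm₃ = solve-∀

  -- Induction on `w` by twos, with `a` raised by one each time. The base w = 0 is an equality and w
  -- = 1 rests on (n + 1) C(2n,n+1) = n C(2n,n). Once a + w exceeds `n` the left side is 0, so
  -- `Step` is entered only with a genuine complement `b`.
  product-upper : ∀ n w a →
    (n C a) * (n C (a + w)) * (n ∸ w) * ((2 * n) C n)
      ≤ (n + w) * ((2 * n) C (n + w)) * ((n C (a + ⌊ w /2⌋)) * (n C (a + ⌈ w /2⌉)))
  product-upper n zero a = ≤-reflexive (begin
    x * (n C (a + 0)) * n * d                                     ≡⟨ cong (λ i → x * (n C i) * n * d) (+-identityʳ a) ⟩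
    x * x * n * d                                                 ≡⟨ perm x n d ⟩
    n * d * (x * x)                                               ≡⟨ cong₂ (λ i j → i * ((2 * n) C i) * ((n C j) * (n C j))) (+-identityʳ n) (+-identityʳ a) ⟨
    (n + 0) * ((2 * n) C (n + 0)) * ((n C (a + 0)) * (n C (a + 0))) ∎)
    where
    open ≡-Reasoning
    x = n C a
    d = (2 * n) C n
    perm : ∀ x n d → x * x * n * d ≡ n * d * (x * x)
    perm = solve-∀
  product-upper n (suc zero) a = begin
    x * y * (n ∸ 1) * d                              ≤⟨ *-monoˡ-≤ d (*-monoʳ-≤ (x * y) (m∸n≤m n 1)) ⟩
    x * y * n * d                                    ≡⟨ perm x y n d ⟩
    n * d * (x * y)                                  ≡⟨ cong (_* (x * y)) D-eq ⟨
    (n + 1) * ((2 * n) C (n + 1)) * (x * y)          ≡⟨ cong (λ i → (n + 1) * ((2 * n) C (n + 1)) * ((n C i) * y)) (+-identityʳ a) ⟨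
    (n + 1) * ((2 * n) C (n + 1)) * ((n C (a + 0)) * y) ∎
    where
    open ≤-Reasoning
    x = n C a
    y = n C (a + 1)
    d = (2 * n) C n
    D-eq : (n + 1) * ((2 * n) C (n + 1)) ≡ n * d
    D-eq = trans (cong (λ i → i * ((2 * n) C i)) (+-comm n 1))
      (binomial-step {2 * n} (cong (n +_) (+-identityʳ n)))
    perm : ∀ x y n d → x * y * n * d ≡ n * d * (x * y)
    perm = solve-∀
  product-upper n (suc (suc w)) a with a + suc (suc w) ≤? n
  ... | no ¬p rewrite k>n⇒nCk≡0 (≰⇒> ¬p) | *-zeroʳ (n C a) = z≤n
  ... | yes p = step (n ∸ (a + suc (suc w))) (trans (sym (m+[n∸m]≡n p)) (idx a w (n ∸ (a + suc (suc w)))))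
    where
    idx : ∀ a w b → a + suc (suc w) + b ≡ a + b + w + 2
    idx = solve-∀
    step : ∀ b → n ≡ a + b + w + 2 →
      (n C a) * (n C (a + suc (suc w))) * (n ∸ suc (suc w)) * ((2 * n) C n)
      ≤ (n + suc (suc w)) * ((2 * n) C (n + suc (suc w))) * ((n C (a + suc ⌊ w /2⌋)) * (n C (a + suc ⌈ w /2⌉)))
    step b refl = subst₂ _≤_ left right (upper-step ((2 * n) C n) L (subst₂ _≤_ left₀ right₀ (product-upper n w (suc a))))
      where
      open Step a b w hiding (n)
      L = (n C suc (a + ⌊ w /2⌋)) * (n C suc (a + ⌈ w /2⌉))
      sub₀ : ∀ a b w → a + b + w + 2 ≡ w + (suc a + suc b)
      sub₀ = solve-∀
      sub₂ : ∀ a b w → a + b + w + 2 ≡ suc (suc w) + (a + b)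
      sub₂ = solve-∀
      coeff₀ : ∀ a b w → a + b + w + 2 + w ≡ a + b + 2 * suc w
      coeff₀ = solve-∀
      coeff₂ : ∀ a b w → suc a + suc b + 2 * suc w ≡ a + b + w + 2 + suc (suc w)
      coeff₂ = solve-∀
      up : ∀ m w → suc (suc (m + w)) ≡ m + suc (suc w)
      up = solve-∀
      left₀ : x₁ * y₁ * (n ∸ w) * ((2 * n) C n) ≡ x₁ * y₁ * (A + B) * ((2 * n) C n)
      left₀ = cong (λ s → x₁ * y₁ * s * ((2 * n) C n)) (trans (cong (_∸ w) (sub₀ a b w)) (m+n∸m≡n w (A + B)))
      right₀ : (n + w) * D₀ * L ≡ (a + b + 2 * W) * D₀ * L
      right₀ = cong (λ s → s * D₀ * L) (coeff₀ a b w)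
      left : x₀ * y₂ * (a + b) * ((2 * n) C n)
        ≡ (n C a) * (n C (a + suc (suc w))) * (n ∸ suc (suc w)) * ((2 * n) C n)
      left = cong₂ (λ i s → x₀ * (n C i) * s * ((2 * n) C n)) (up a w)
        (sym (trans (cong (_∸ suc (suc w)) (sub₂ a b w)) (m+n∸m≡n (suc (suc w)) (a + b))))
      right : (A + B + 2 * W) * D₂ * L
        ≡ (n + suc (suc w)) * ((2 * n) C (n + suc (suc w))) * ((n C (a + suc ⌊ w /2⌋)) * (n C (a + suc ⌈ w /2⌉)))
      right = cong₂ _*_ (cong₂ (λ s i → s * ((2 * n) C i)) (coeff₂ a b w) (up n w))
        (cong₂ (λ i j → (n C i) * (n C j)) (sym (+-suc a ⌊ w /2⌋)) (sym (+-suc a ⌈ w /2⌉)))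

  -- The same descent raises `a` and `b` together, so that their near equality persists down to the
  -- base. At w = 1 it is the maximality of C(2n,n).
  product-lower : ∀ n w a b → a + b + w ≡ n → a ≤ suc b → b ≤ suc a →
    ((2 * n) C (n + w)) * ((n C (a + ⌊ w /2⌋)) * (n C (a + ⌈ w /2⌉))) ≤ (n C a) * (n C (a + w)) * ((2 * n) C n)
  product-lower n zero a b _ _ _ = ≤-reflexive (trans (*-comm ((2 * n) C (n + 0)) _)
    (cong₂ (λ i j → (n C j) * (n C (a + 0)) * ((2 * n) C i)) (+-identityʳ n) (+-identityʳ a)))
  product-lower n (suc zero) a b _ _ _ = begin
    ((2 * n) C (n + 1)) * ((n C (a + 0)) * y)  ≤⟨ *-monoˡ-≤ _ (nC[k+j]≤nCk (2 * n) n 1 (≤-reflexive (cong (n +_) (+-identityʳ n)))) ⟩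
    d * ((n C (a + 0)) * y)                    ≡⟨ cong (λ i → d * ((n C i) * y)) (+-identityʳ a) ⟩
    d * ((n C a) * y)                          ≡⟨ *-comm d _ ⟩
    (n C a) * y * d                            ∎
    where
    open ≤-Reasoning
    y = n C (a + 1)
    d = (2 * n) C n
  product-lower n (suc (suc w)) a b eq a≤1+b b≤1+a = step (trans (sym eq) (idx a b w))
    where
    idx : ∀ a b w → a + b + suc (suc w) ≡ a + b + w + 2
    idx = solve-∀
    idx₀ : ∀ a b w → suc a + suc b + w ≡ a + b + w + 2
    idx₀ = solve-∀
    up : ∀ m w → suc (suc (m + w)) ≡ m + suc (suc w)
    up = solve-∀
    step : n ≡ a + b + w + 2 →
      ((2 * n) C (n + suc (suc w))) * ((n C (a + suc ⌊ w /2⌋)) * (n C (a + suc ⌈ w /2⌉)))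
      ≤ (n C a) * (n C (a + suc (suc w))) * ((2 * n) C n)
    step refl = subst₂ _≤_ left right
      (lower-step ((2 * n) C n) L a≤1+b b≤1+a (product-lower n w (suc a) (suc b) (idx₀ a b w) (s≤s a≤1+b) (s≤s b≤1+a)))
      where
      open Step a b w hiding (n)
      L = (n C suc (a + ⌊ w /2⌋)) * (n C suc (a + ⌈ w /2⌉))
      left : D₂ * L ≡ ((2 * n) C (n + suc (suc w))) * ((n C (a + suc ⌊ w /2⌋)) * (n C (a + suc ⌈ w /2⌉)))
      left = cong₂ _*_ (cong ((2 * n) C_) (up n w))
        (cong₂ (λ i j → (n C i) * (n C j)) (sym (+-suc a ⌊ w /2⌋)) (sym (+-suc a ⌈ w /2⌉)))
      right : x₀ * y₂ * ((2 * n) C n) ≡ (n C a) * (n C (a + suc (suc w))) * ((2 * n) C n)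
      right = cong (λ i → x₀ * (n C i) * ((2 * n) C n)) (up a w)

  -- The squared ratio, and explicit margins around 2.

  module RatioBounds (n w a : ℕ) where
    private
      X  = (n C a) * (n C (a + w))
      c₀ = n C (a + ⌊ w /2⌋)
      c₁ = n C (a + ⌈ w /2⌉)
      E  = 2 ^ n
      d  = (2 * n) C n
      dw = (2 * n) C (n + w)

      instance
        d²≢0 : NonZero (d * d)
        d²≢0 = m*n≢0 d d {{d≢0}} {{d≢0}}
          where
          d≢0 : NonZero d
          d≢0 = >-nonZero (k≤n⇒nCk>0 (m≤m+n n (n + 0)))

    numerator denominator : ℕ
    numerator   = 2 ^ n * ((n C a) * (n C (a + w)))
    denominator = ((2 * n) C (n + w)) * (n C (a + ⌈ w /2⌉))

    -- `product-upper` bounds the numerator by a multiple of `c₀ * c₁`. Here `c₁` is the binomial of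
    -- ψ in `denominator`, and 2ⁿ `c₀` is what `central-upper` compares with C(2n,n).
    ratio²-upper : 1 ≤ n →
      numerator * numerator * ((n ∸ w) * (n ∸ w)) ≤ 2 * ((n + w) * (n + w)) * (denominator * denominator)
    ratio²-upper 1≤n = *-cancelˡ-≤ (d * d) (begin
      d * d * (E * X * (E * X) * (m * m))                  ≡⟨ perm₁ d E X m ⟩
      E * E * ((X * m * d) * (X * m * d))                  ≤⟨ *-monoʳ-≤ (E * E) (square-mono-≤ (product-upper n w a)) ⟩
      E * E * ((s * dw * (c₀ * c₁)) * (s * dw * (c₀ * c₁))) ≡⟨ perm₂ E s dw c₀ c₁ ⟩
      s * s * (dw * c₁ * (dw * c₁)) * (E * E * (c₀ * c₀))  ≤⟨ *-monoʳ-≤ (s * s * (dw * c₁ * (dw * c₁))) (central-upper n (a + ⌊ w /2⌋) 1≤n) ⟩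
      s * s * (dw * c₁ * (dw * c₁)) * (2 * (d * d))        ≡⟨ perm₃ (s * s) (dw * c₁ * (dw * c₁)) (d * d) ⟩
      d * d * (2 * (s * s) * (dw * c₁ * (dw * c₁)))        ∎)
      where
      open ≤-Reasoning
      m = n ∸ w
      s = n + w
      perm₁ : ∀ d E X m → d * d * (E * X * (E * X) * (m * m)) ≡ E * E * ((X * m * d) * (X * m * d))
      perm₁ = solve-∀
      perm₂ : ∀ E s dw c₀ c₁ → E * E * ((s * dw * (c₀ * c₁)) * (s * dw * (c₀ * c₁)))
        ≡ s * s * (dw * c₁ * (dw * c₁)) * (E * E * (c₀ * c₀))
      perm₂ = solve-∀
      perm₃ : ∀ s q d → s * q * (2 * d) ≡ d * (2 * s * q)
      perm₃ = solve-∀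

    -- The last hypothesis makes `c₀` the central entry of row `n`, to which `central-lower`
    -- applies; the two before it feed `product-lower`.
    ratio²-lower : ∀ b → a + b + w ≡ n → a ≤ suc b → b ≤ suc a → a + ⌊ w /2⌋ ≡ ⌊ n /2⌋ →
      (2 * n + 1) * (denominator * denominator) ≤ (n + 2) * (numerator * numerator)
    ratio²-lower b eq a≤1+b b≤1+a mid = *-cancelˡ-≤ (d * d) (begin
      d * d * ((2 * n + 1) * (dw * c₁ * (dw * c₁)))          ≡⟨ perm₁ (d * d) (2 * n + 1) (dw * c₁ * (dw * c₁)) ⟩
      dw * c₁ * (dw * c₁) * ((2 * n + 1) * (d * d))          ≤⟨ *-monoʳ-≤ (dw * c₁ * (dw * c₁)) central ⟩
      dw * c₁ * (dw * c₁) * ((n + 2) * (E * E * (c₀ * c₀)))  ≡⟨ perm₂ dw c₀ c₁ (n + 2) E ⟩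
      (n + 2) * (E * E) * ((dw * (c₀ * c₁)) * (dw * (c₀ * c₁))) ≤⟨ *-monoʳ-≤ ((n + 2) * (E * E)) (square-mono-≤ (product-lower n w a b eq a≤1+b b≤1+a)) ⟩
      (n + 2) * (E * E) * (X * d * (X * d))                  ≡⟨ perm₃ (n + 2) E X d ⟩
      d * d * ((n + 2) * (E * X * (E * X)))                  ∎)
      where
      open ≤-Reasoning
      central : (2 * n + 1) * (d * d) ≤ (n + 2) * (E * E * (c₀ * c₀))
      central = subst (λ i → (2 * n + 1) * (d * d) ≤ (n + 2) * (E * E * ((n C i) * (n C i)))) (sym mid) (central-lower n)
      perm₁ : ∀ d s q → d * (s * q) ≡ q * (s * d)
      perm₁ = solve-∀
      perm₂ : ∀ dw c₀ c₁ s E → dw * c₁ * (dw * c₁) * (s * (E * E * (c₀ * c₀)))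
        ≡ s * (E * E) * ((dw * (c₀ * c₁)) * (dw * (c₀ * c₁)))
      perm₂ = solve-∀
      perm₃ : ∀ s E X d → s * (E * E) * (X * d * (X * d)) ≡ d * d * (s * (E * X * (E * X)))
      perm₃ = solve-∀

  -- With r = 16d², the hypothesis (r + 1)w ≤ n says rw ≤ n - w, hence (n + w)/(n - w) ≤ 1 + 2/r.
  -- The 16 is large enough for 2(1 + 2/r)² < 2 + 1/d², which is `poly`.
  near-2-upper : ∀ {n w p q d} → 1 ≤ n → 1 ≤ d → 1 ≤ q → (16 * (d * d) + 1) * w ≤ n →
    p * p * ((n ∸ w) * (n ∸ w)) ≤ 2 * ((n + w) * (n + w)) * (q * q) →
    d * d * (p * p) < (2 * (d * d) + 1) * (q * q)
  near-2-upper {n} {w} {p} {q} {d} 1≤n 1≤d 1≤q tw≤n hyp = *-cancelˡ-< (r * r) _ _ (begin-strict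
    r * r * (e * (p * p))              ≤⟨ *-cancelˡ-≤ (m * m) {{m*n≢0 m m}} scaled ⟩
    2 * e * ((r + 2) * (r + 2)) * (q * q) <⟨ *-monoˡ-< (q * q) {{m*n≢0 q q}} (poly e 1≤e) ⟩
    (2 * e + 1) * (r * r) * (q * q)    ≡⟨ perm₀ (2 * e + 1) (r * r) (q * q) ⟩
    r * r * ((2 * e + 1) * (q * q))    ∎)
    where
    open ≤-Reasoning
    e = d * d
    r = 16 * e
    m = n ∸ w
    s = n + w
    1≤e : 1 ≤ e
    1≤e = *-mono-≤ 1≤d 1≤d
    w≤n : w ≤ n
    w≤n = ≤-trans (m≤n*m w (16 * (d * d) + 1) {{>-nonZero (m≤n+m 1 r)}}) tw≤n
    m+w≡n : m + w ≡ n
    m+w≡n = m∸n+n≡m w≤n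
    rw≤m : r * w ≤ m
    rw≤m = +-cancelʳ-≤ w _ _ (begin
      r * w + w       ≡⟨ split r w ⟩
      (r + 1) * w     ≤⟨ tw≤n ⟩
      n               ≡⟨ m+w≡n ⟨
      m + w           ∎)
      where
      split : ∀ r w → r * w + w ≡ (r + 1) * w
      split = solve-∀
    rs≤[r+2]m : r * s ≤ (r + 2) * m
    rs≤[r+2]m = begin
      r * (n + w)          ≡⟨ cong (λ i → r * (i + w)) m+w≡n ⟨
      r * (m + w + w)      ≡⟨ expand r m w ⟩
      r * m + 2 * (r * w)  ≤⟨ +-monoʳ-≤ (r * m) (*-monoʳ-≤ 2 rw≤m) ⟩
      r * m + 2 * m        ≡⟨ *-distribʳ-+ m r 2 ⟨
      (r + 2) * m          ∎
      where
      expand : ∀ r m w → r * (m + w + w) ≡ r * m + 2 * (r * w)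
      expand = solve-∀
    instance
      q≢0 : NonZero q
      q≢0 = >-nonZero 1≤q
      m≢0 : NonZero m
      m≢0 = ≢-nonZero λ m≡0 → <⇒≱ (*-mono-≤ {1} (≤-trans 1≤e (m≤n*m e 16)) (≤-trans 1≤n (m≤m+n n w)))
        (≤-trans rs≤[r+2]m (≤-reflexive (trans (cong ((r + 2) *_) m≡0) (*-zeroʳ (r + 2)))))
    scaled : m * m * (r * r * (e * (p * p))) ≤ m * m * (2 * e * ((r + 2) * (r + 2)) * (q * q))
    scaled = begin
      m * m * (r * r * (e * (p * p)))              ≡⟨ perm₁ m r e p ⟩
      r * r * e * (p * p * (m * m))                ≤⟨ *-monoʳ-≤ (r * r * e) hyp ⟩
      r * r * e * (2 * (s * s) * (q * q))          ≡⟨ perm₂ r e s q ⟩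
      (r * s) * (r * s) * (2 * e * (q * q))        ≤⟨ *-monoˡ-≤ (2 * e * (q * q)) (square-mono-≤ rs≤[r+2]m) ⟩
      ((r + 2) * m) * ((r + 2) * m) * (2 * e * (q * q)) ≡⟨ perm₃ (r + 2) m e q ⟩
      m * m * (2 * e * ((r + 2) * (r + 2)) * (q * q)) ∎
      where
      perm₁ : ∀ m r e p → m * m * (r * r * (e * (p * p))) ≡ r * r * e * (p * p * (m * m))
      perm₁ = solve-∀
      perm₂ : ∀ r e s q → r * r * e * (2 * (s * s) * (q * q)) ≡ (r * s) * (r * s) * (2 * e * (q * q))
      perm₂ = solve-∀
      perm₃ : ∀ t m e q → (t * m) * (t * m) * (2 * e * (q * q)) ≡ m * m * (2 * e * (t * t) * (q * q))
      perm₃ = solve-∀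
    perm₀ : ∀ t r q → t * r * q ≡ r * (t * q)
    perm₀ = solve-∀
    poly : ∀ e → 1 ≤ e → 2 * e * ((16 * e + 2) * (16 * e + 2)) < (2 * e + 1) * (16 * e * (16 * e))
    -- Shifting `e` by one turns the gap 128e² - 8e - 1 into a polynomial with natural coefficients.
    poly (suc e) _ = slack (128 * e * e + 248 * e + 119) (identity e)
      where
      identity : ∀ e → suc (2 * suc e * ((16 * suc e + 2) * (16 * suc e + 2))) + (128 * e * e + 248 * e + 119)
        ≡ (2 * suc e + 1) * (16 * suc e * (16 * suc e))
      identity = solve-∀

  -- (2n + 1)/(n + 2) = 2 - 3/(n + 2), and 3d² < n + 2 makes the defect smaller than 1/d².
  near-2-lower : ∀ {n p q d} → 3 * (d * d) ≤ n → 1 ≤ q →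
    (2 * n + 1) * (q * q) ≤ (n + 2) * (p * p) →
    2 * (d * d) * (q * q) < d * d * (p * p) + q * q
  near-2-lower {n} {p} {q} {d} 3d²≤n 1≤q hyp = *-cancelˡ-< (n + 2) _ _ (begin-strict
    (n + 2) * (2 * e * (q * q))                            ≡⟨ perm₁ n e (q * q) ⟩
    e * ((2 * n + 1) * (q * q)) + 3 * e * (q * q)          ≤⟨ +-monoˡ-≤ (3 * e * (q * q)) (*-monoʳ-≤ e hyp) ⟩
    e * ((n + 2) * (p * p)) + 3 * e * (q * q)              <⟨ +-monoʳ-< (e * ((n + 2) * (p * p))) (*-monoˡ-< (q * q) {{m*n≢0 q q}} 3e<n+2) ⟩
    e * ((n + 2) * (p * p)) + (n + 2) * (q * q)            ≡⟨ perm₂ e (n + 2) (p * p) (q * q) ⟩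
    (n + 2) * (e * (p * p) + q * q)                        ∎)
    where
    open ≤-Reasoning
    e = d * d
    instance
      q≢0 : NonZero q
      q≢0 = >-nonZero 1≤q
    3e<n+2 : 3 * e < n + 2
    3e<n+2 = ≤-<-trans 3d²≤n (m<m+n n z<s)
    perm₁ : ∀ n e q → (n + 2) * (2 * e * q) ≡ e * ((2 * n + 1) * q) + 3 * e * q
    perm₁ = solve-∀
    perm₂ : ∀ e t p q → e * (t * p) + t * q ≡ t * (e * p + q)
    perm₂ = solve-∀

-- Transfer between inequalities in ℚ and in ℕ.

module RationalBounds where
  open import Defs
  open import Data.Nat as ℕ using (ℕ; suc; zero)
  import Data.Nat.Properties as ℕ
  open import Data.Integer as ℤ using (ℤ; +_; -[1+_])
  import Data.Integer.Properties as ℤ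
  open import Data.Rational as ℚ using (ℚ; 0ℚ; _+_; _*_; _-_; _≤_; _<_; _/_; mkℚ; toℚᵘ)
  open import Data.Rational.Properties
  open import Data.Rational.Solver using (module +-*-Solver)
  open import Data.Rational.Unnormalised as ℚᵘ using (mkℚᵘ; *≡*; *≤*; *<*)
  import Data.Rational.Unnormalised.Properties as ℚᵘ
  open import Data.Product using (_×_; _,_; ∃-syntax)
  open import Data.Sum using (_⊎_; inj₁; inj₂)
  open import Data.Empty using (⊥-elim)
  open import Relation.Nullary using (¬_; yes; no)
  open import Relation.Binary.PropositionalEquality

  <⇒≱ : ∀ {p q} → p < q → ¬ q ≤ p
  <⇒≱ p<q q≤p = <-irrefl refl (<-≤-trans p<q q≤p)

  ι : ℕ → ℚ
  ι n = toℚ (+ n)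

  -- `toℚ` normalises by a gcd that does not compute on variables. In unnormalised rationals the
  -- homomorphism laws of `ι` become plain integer identities.
  toℚᵘ-ι : ∀ n → toℚᵘ (ι n) ℚᵘ.≃ mkℚᵘ (+ n) 0
  toℚᵘ-ι n = toℚᵘ-fromℚᵘ (mkℚᵘ (+ n) 0)

  ι-+ : ∀ m n → ι (m ℕ.+ n) ≡ ι m + ι n
  ι-+ m n = toℚᵘ-injective (begin
    toℚᵘ (ι (m ℕ.+ n))                ≈⟨ toℚᵘ-ι (m ℕ.+ n) ⟩
    mkℚᵘ (+ (m ℕ.+ n)) 0              ≈⟨ *≡* (cong (ℤ._* + 1) (cong₂ ℤ._+_ (sym (ℤ.*-identityʳ (+ m))) (sym (ℤ.*-identityʳ (+ n))))) ⟩
    mkℚᵘ (+ m) 0 ℚᵘ.+ mkℚᵘ (+ n) 0    ≈⟨ ℚᵘ.+-cong (toℚᵘ-ι m) (toℚᵘ-ι n) ⟨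
    toℚᵘ (ι m) ℚᵘ.+ toℚᵘ (ι n)        ≈⟨ toℚᵘ-homo-+ (ι m) (ι n) ⟨
    toℚᵘ (ι m + ι n)                  ∎)
    where open ℚᵘ.≃-Reasoning

  ι-* : ∀ m n → ι (m ℕ.* n) ≡ ι m * ι n
  ι-* m n = toℚᵘ-injective (begin
    toℚᵘ (ι (m ℕ.* n))                ≈⟨ toℚᵘ-ι (m ℕ.* n) ⟩
    mkℚᵘ (+ (m ℕ.* n)) 0              ≈⟨ *≡* (cong (ℤ._* + 1) (ℤ.pos-* m n)) ⟩
    mkℚᵘ (+ m) 0 ℚᵘ.* mkℚᵘ (+ n) 0    ≈⟨ ℚᵘ.*-cong (toℚᵘ-ι m) (toℚᵘ-ι n) ⟨
    toℚᵘ (ι m) ℚᵘ.* toℚᵘ (ι n)        ≈⟨ toℚᵘ-homo-* (ι m) (ι n) ⟨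
    toℚᵘ (ι m * ι n)                  ∎)
    where open ℚᵘ.≃-Reasoning

  ι-mono-≤ : ∀ {m n} → m ℕ.≤ n → ι m ≤ ι n
  ι-mono-≤ {m} {n} m≤n = toℚᵘ-cancel-≤ (begin
    toℚᵘ (ι m)     ≃⟨ toℚᵘ-ι m ⟩
    mkℚᵘ (+ m) 0   ≤⟨ *≤* (ℤ.*-monoʳ-≤-nonNeg (+ 1) (ℤ.+≤+ m≤n)) ⟩
    mkℚᵘ (+ n) 0   ≃⟨ toℚᵘ-ι n ⟨
    toℚᵘ (ι n)     ∎)
    where open ℚᵘ.≤-Reasoning

  ι-mono-< : ∀ {m n} → m ℕ.< n → ι m < ι n
  ι-mono-< {m} {n} m<n = toℚᵘ-cancel-< (begin-strict
    toℚᵘ (ι m)     ≃⟨ toℚᵘ-ι m ⟩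
    mkℚᵘ (+ m) 0   <⟨ *<* (ℤ.*-monoʳ-<-pos (+ 1) (ℤ.+<+ m<n)) ⟩
    mkℚᵘ (+ n) 0   ≃⟨ toℚᵘ-ι n ⟨
    toℚᵘ (ι n)     ∎)
    where open ℚᵘ.≤-Reasoning

  ι-cancel-≤ : ∀ {m n} → ι m ≤ ι n → m ℕ.≤ n
  ι-cancel-≤ {m} {n} ιm≤ιn with m ℕ.≤? n
  ... | yes m≤n = m≤n
  ... | no  m≰n = ⊥-elim (<⇒≱ (ι-mono-< (ℕ.≰⇒> m≰n)) ιm≤ιn)

  ι-nonNeg : ∀ n → ℚ.NonNegative (ι n)
  ι-nonNeg n = ℚ.nonNegative (ι-mono-≤ {0} {n} ℕ.z≤n)

  ι-pos : ∀ n → .{{ℕ.NonZero n}} → ℚ.Positive (ι n)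
  ι-pos (suc n) = ℚ.positive (ι-mono-< {0} {suc n} ℕ.z<s)

  -- The cross-multiplied form in which the fractions c, ε, f, ψ and their ratio are handled from
  -- here on; no fraction has to be reduced.
  /-*-cancel : ∀ m d .{{_ : ℕ.NonZero d}} → (+ m / d) * ι d ≡ ι m
  /-*-cancel m (suc d) = toℚᵘ-injective (begin
    toℚᵘ ((+ m / suc d) * ι (suc d))           ≈⟨ toℚᵘ-homo-* (+ m / suc d) (ι (suc d)) ⟩
    toℚᵘ (+ m / suc d) ℚᵘ.* toℚᵘ (ι (suc d))   ≈⟨ ℚᵘ.*-cong (toℚᵘ-fromℚᵘ (mkℚᵘ (+ m) d)) (toℚᵘ-ι (suc d)) ⟩
    mkℚᵘ (+ m) d ℚᵘ.* mkℚᵘ (+ suc d) 0         ≈⟨ *≡* (trans (ℤ.*-identityʳ (+ m ℤ.* + suc d)) (cong (λ k → + m ℤ.* + k) (sym (ℕ.*-identityʳ (suc d))))) ⟩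
    mkℚᵘ (+ m) 0                               ≈⟨ toℚᵘ-ι m ⟨
    toℚᵘ (ι m)                                 ∎)
    where open ℚᵘ.≃-Reasoning

  positive-fraction : ∀ q → 0ℚ < q → ∃[ m ] ∃[ d ] (1 ℕ.≤ m × 1 ℕ.≤ d × q * ι d ≡ ι m)
  positive-fraction q@(mkℚ (+ suc m) d _) _ =
    suc m , suc d , ℕ.s≤s ℕ.z≤n , ℕ.s≤s ℕ.z≤n ,
    trans (cong (_* ι (suc d)) (sym (↥p/↧p≡p q))) (/-*-cancel (suc m) (suc d))
  positive-fraction (mkℚ (+ zero) d _) 0<q with drop-*<* 0<q
  ... | ℤ.+<+ ()
  positive-fraction (mkℚ -[1+ m ] d _) 0<q with drop-*<* 0<q
  ... | ()

  square-ι : ∀ q p d → q * ι d ≡ ι p → q * q * ι (d ℕ.* d) ≡ ι (p ℕ.* p)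
  square-ι q p d eq = begin
    q * q * ι (d ℕ.* d)      ≡⟨ cong (q * q *_) (ι-* d d) ⟩
    q * q * (ι d * ι d)      ≡⟨ solve 2 (λ q d → q :* q :* (d :* d) := (q :* d) :* (q :* d)) refl q (ι d) ⟩
    (q * ι d) * (q * ι d)    ≡⟨ cong (λ x → x * x) eq ⟩
    ι p * ι p                ≡⟨ ι-* p p ⟨
    ι (p ℕ.* p)              ∎
    where
    open ≡-Reasoning
    open +-*-Solver

  module _ (q ε : ℚ) (P Q e d : ℕ) (qQ≡P : q * ι Q ≡ ι P) (εd≡e : ε * ι d ≡ ι e) where
    private
      scale = ι (d ℕ.* d ℕ.* (Q ℕ.* Q))

      q²-scaled : q * q * scale ≡ ι (d ℕ.* d ℕ.* (P ℕ.* P))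
      q²-scaled = begin
        q * q * scale                           ≡⟨ cong (q * q *_) (ι-* (d ℕ.* d) (Q ℕ.* Q)) ⟩
        q * q * (ι (d ℕ.* d) * ι (Q ℕ.* Q))     ≡⟨ solve 3 (λ q d Q → q :* (d :* Q) := d :* (q :* Q)) refl (q * q) (ι (d ℕ.* d)) (ι (Q ℕ.* Q)) ⟩
        ι (d ℕ.* d) * (q * q * ι (Q ℕ.* Q))     ≡⟨ cong (ι (d ℕ.* d) *_) (square-ι q P Q qQ≡P) ⟩
        ι (d ℕ.* d) * ι (P ℕ.* P)               ≡⟨ ι-* (d ℕ.* d) (P ℕ.* P) ⟨
        ι (d ℕ.* d ℕ.* (P ℕ.* P))               ∎
        where
        open ≡-Reasoning
        open +-*-Solver

      ε²-scaled : ε * ε * scale ≡ ι (e ℕ.* e ℕ.* (Q ℕ.* Q))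
      ε²-scaled = begin
        ε * ε * scale                           ≡⟨ cong (ε * ε *_) (ι-* (d ℕ.* d) (Q ℕ.* Q)) ⟩
        ε * ε * (ι (d ℕ.* d) * ι (Q ℕ.* Q))     ≡⟨ *-assoc (ε * ε) (ι (d ℕ.* d)) (ι (Q ℕ.* Q)) ⟨
        ε * ε * ι (d ℕ.* d) * ι (Q ℕ.* Q)       ≡⟨ cong (_* ι (Q ℕ.* Q)) (square-ι ε e d εd≡e) ⟩
        ι (e ℕ.* e) * ι (Q ℕ.* Q)               ≡⟨ ι-* (e ℕ.* e) (Q ℕ.* Q) ⟨
        ι (e ℕ.* e ℕ.* (Q ℕ.* Q))               ∎
        where open ≡-Reasoning

      2-scaled : ι 2 * scale ≡ ι (2 ℕ.* (d ℕ.* d) ℕ.* (Q ℕ.* Q))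
      2-scaled = trans (sym (ι-* 2 (d ℕ.* d ℕ.* (Q ℕ.* Q)))) (cong ι (sym (ℕ.*-assoc 2 (d ℕ.* d) (Q ℕ.* Q))))

      Q²≤e²Q² : 1 ℕ.≤ e → Q ℕ.* Q ℕ.≤ e ℕ.* e ℕ.* (Q ℕ.* Q)
      Q²≤e²Q² 1≤e = ℕ.m≤n*m (Q ℕ.* Q) (e ℕ.* e) {{ℕ.>-nonZero (ℕ.*-mono-≤ 1≤e 1≤e)}}

    -- Multiplication by d²Q² moves the claim to ℕ. The natural-number bound has margin 1/d², and ε
    -- = e/d with e ≥ 1 gives 1/d² ≤ ε².
    q²<2+ε² : 1 ℕ.≤ e → d ℕ.* d ℕ.* (P ℕ.* P) ℕ.< (2 ℕ.* (d ℕ.* d) ℕ.+ 1) ℕ.* (Q ℕ.* Q) →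
      q * q < ι 2 + ε * ε
    q²<2+ε² 1≤e bound = *-cancelʳ-<-nonNeg scale {{ι-nonNeg (d ℕ.* d ℕ.* (Q ℕ.* Q))}} (begin-strict
      q * q * scale                                                          ≡⟨ q²-scaled ⟩
      ι (d ℕ.* d ℕ.* (P ℕ.* P))                                              <⟨ ι-mono-< bound′ ⟩
      ι (2 ℕ.* (d ℕ.* d) ℕ.* (Q ℕ.* Q) ℕ.+ e ℕ.* e ℕ.* (Q ℕ.* Q))            ≡⟨ ι-+ (2 ℕ.* (d ℕ.* d) ℕ.* (Q ℕ.* Q)) _ ⟩
      ι (2 ℕ.* (d ℕ.* d) ℕ.* (Q ℕ.* Q)) + ι (e ℕ.* e ℕ.* (Q ℕ.* Q))          ≡⟨ cong₂ _+_ 2-scaled ε²-scaled ⟨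
      ι 2 * scale + ε * ε * scale                                            ≡⟨ *-distribʳ-+ scale (ι 2) (ε * ε) ⟨
      (ι 2 + ε * ε) * scale                                                  ∎)
      where
      open ≤-Reasoning
      bound′ = ℕ.<-≤-trans bound (ℕ.≤-trans (ℕ.≤-reflexive (ℕ.*-distribʳ-+ (Q ℕ.* Q) (2 ℕ.* (d ℕ.* d)) 1))
        (ℕ.+-monoʳ-≤ (2 ℕ.* (d ℕ.* d) ℕ.* (Q ℕ.* Q)) (ℕ.≤-trans (ℕ.≤-reflexive (ℕ.*-identityˡ (Q ℕ.* Q))) (Q²≤e²Q² 1≤e))))

    2<q²+ε² : 1 ℕ.≤ e → 2 ℕ.* (d ℕ.* d) ℕ.* (Q ℕ.* Q) ℕ.< d ℕ.* d ℕ.* (P ℕ.* P) ℕ.+ Q ℕ.* Q →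
      ι 2 < q * q + ε * ε
    2<q²+ε² 1≤e bound = *-cancelʳ-<-nonNeg scale {{ι-nonNeg (d ℕ.* d ℕ.* (Q ℕ.* Q))}} (begin-strict
      ι 2 * scale                                                            ≡⟨ 2-scaled ⟩
      ι (2 ℕ.* (d ℕ.* d) ℕ.* (Q ℕ.* Q))                                      <⟨ ι-mono-< (ℕ.<-≤-trans bound (ℕ.+-monoʳ-≤ (d ℕ.* d ℕ.* (P ℕ.* P)) (Q²≤e²Q² 1≤e))) ⟩
      ι (d ℕ.* d ℕ.* (P ℕ.* P) ℕ.+ e ℕ.* e ℕ.* (Q ℕ.* Q))                    ≡⟨ ι-+ (d ℕ.* d ℕ.* (P ℕ.* P)) _ ⟩
      ι (d ℕ.* d ℕ.* (P ℕ.* P)) + ι (e ℕ.* e ℕ.* (Q ℕ.* Q))                  ≡⟨ cong₂ _+_ q²-scaled ε²-scaled ⟨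
      q * q * scale + ε * ε * scale                                          ≡⟨ *-distribʳ-+ scale (q * q) (ε * ε) ⟨
      (q * q + ε * ε) * scale                                                ∎)
      where open ≤-Reasoning

  BelowSqrt2+ : ℚ → ℚ → Set
  BelowSqrt2+ q ε = (q - ε < 0ℚ) ⊎ ((q - ε) * (q - ε) < ι 2)

  -- With r = q - ε ≥ 0, a value r² ≥ 2 would force q² = r² + 2εr + ε² ≥ 2 + ε².
  below-√2+ε : ∀ q ε → 0ℚ < ε → q * q < ι 2 + ε * ε → BelowSqrt2+ q ε
  below-√2+ε q ε 0<ε q²<2+ε² with (q - ε) <? 0ℚ
  ... | yes lt = inj₁ lt
  ... | no  ge = inj₂ (≰⇒> λ 2≤ → <⇒≱ q²<2+ε² (begin
      ι 2 + ε * ε                                      ≤⟨ +-monoˡ-≤ (ε * ε) 2≤ ⟩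
      r * r + ε * ε                                    ≡⟨ +-identityʳ _ ⟨
      r * r + ε * ε + 0ℚ                               ≤⟨ +-monoʳ-≤ (r * r + ε * ε) 0≤cross ⟩
      r * r + ε * ε + (ε * r + ε * r)                  ≡⟨ solve 2 (λ q ε → (q :- ε) :* (q :- ε) :+ ε :* ε :+ (ε :* (q :- ε) :+ ε :* (q :- ε)) := q :* q) refl q ε ⟩
      q * q                                            ∎))
    where
    open ≤-Reasoning
    open +-*-Solver
    r = q - ε
    instance
      r≥0 : ℚ.NonNegative r
      r≥0 = ℚ.nonNegative (≮⇒≥ ge)
      ε≥0 : ℚ.NonNegative ε
      ε≥0 = ℚ.nonNegative (<⇒≤ 0<ε)
      εr≥0 : ℚ.NonNegative (ε * r)
      εr≥0 = nonNeg*nonNeg⇒nonNeg ε r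
    0≤cross : 0ℚ ≤ ε * r + ε * r
    0≤cross = nonNegative⁻¹ _ {{nonNeg+nonNeg⇒nonNeg (ε * r) (ε * r)}}

  -- Here `q₀` is one ratio and `q` the maximum above it: (q + ε)² exceeds q₀² + ε² by nonnegative
  -- terms, among them the cross term 2εq.
  above-√2-ε : ∀ q₀ q ε → 0ℚ < ε → 0ℚ ≤ q₀ → q₀ ≤ q → ι 2 < q₀ * q₀ + ε * ε →
    0ℚ < q + ε × ι 2 < (q + ε) * (q + ε)
  above-√2-ε q₀ q ε 0<ε 0≤q₀ q₀≤q 2<q₀²+ε² =
    positive⁻¹ (q + ε) {{nonNeg+pos⇒pos q ε}} , (begin-strict
      ι 2                                    <⟨ 2<q₀²+ε² ⟩
      q₀ * q₀ + ε * ε                        ≤⟨ +-monoˡ-≤ (ε * ε) (≤-trans (*-monoˡ-≤-nonNeg q₀ q₀≤q) (*-monoʳ-≤-nonNeg q q₀≤q)) ⟩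
      q * q + ε * ε                          ≡⟨ +-identityʳ _ ⟨
      q * q + ε * ε + 0ℚ                     ≤⟨ +-monoʳ-≤ (q * q + ε * ε) 0≤cross ⟩
      q * q + ε * ε + (ε * q + ε * q)        ≡⟨ solve 2 (λ q ε → q :* q :+ ε :* ε :+ (ε :* q :+ ε :* q) := (q :+ ε) :* (q :+ ε)) refl q ε ⟩
      (q + ε) * (q + ε)                      ∎)
    where
    open ≤-Reasoning
    open +-*-Solver
    instance
      q₀≥0 : ℚ.NonNegative q₀
      q₀≥0 = ℚ.nonNegative 0≤q₀
      q≥0 : ℚ.NonNegative q
      q≥0 = ℚ.nonNegative (≤-trans 0≤q₀ q₀≤q)
      ε>0 : ℚ.Positive ε
      ε>0 = ℚ.positive 0<ε
      ε≥0 : ℚ.NonNegative ε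
      ε≥0 = ℚ.nonNegative (<⇒≤ 0<ε)
      εq≥0 : ℚ.NonNegative (ε * q)
      εq≥0 = nonNeg*nonNeg⇒nonNeg ε q
    0≤cross : 0ℚ ≤ ε * q + ε * q
    0≤cross = nonNegative⁻¹ _ {{nonNeg+nonNeg⇒nonNeg (ε * q) (ε * q)}}

  square-abs : ∀ x → x ℤ.* x ≡ + (ℤ.∣ x ∣ ℕ.* ℤ.∣ x ∣)
  square-abs (+ m)    = sym (ℤ.pos-* m m)
  square-abs -[1+ m ] = refl

  module _ (c : ℚ) (p k : ℕ) .{{_ : ℕ.NonZero k}} (ck≡p : c * ι k ≡ ι p) (n : ℕ) (x : ℤ) where
    private
      X = ℤ.∣ x ∣ ℕ.* ℤ.∣ x ∣
      instance
        k²≢0 : ℕ.NonZero (k ℕ.* k)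
        k²≢0 = ℕ.m*n≢0 k k

      x²-scaled : toℚ (x ℤ.* x) * ι (k ℕ.* k) ≡ ι (X ℕ.* (k ℕ.* k))
      x²-scaled = trans (cong (λ i → toℚ i * ι (k ℕ.* k)) (square-abs x)) (sym (ι-* X (k ℕ.* k)))

      c²n-scaled : c * c * ι n * ι (k ℕ.* k) ≡ ι (p ℕ.* p ℕ.* n)
      c²n-scaled = begin
        c * c * ι n * ι (k ℕ.* k)    ≡⟨ solve 3 (λ c n k → c :* n :* k := c :* k :* n) refl (c * c) (ι n) (ι (k ℕ.* k)) ⟩
        c * c * ι (k ℕ.* k) * ι n    ≡⟨ cong (_* ι n) (square-ι c p k ck≡p) ⟩
        ι (p ℕ.* p) * ι n            ≡⟨ ι-* (p ℕ.* p) n ⟨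
        ι (p ℕ.* p ℕ.* n)            ∎
        where
        open ≡-Reasoning
        open +-*-Solver

    InRange⇒ : InRange c n x → X ℕ.* (k ℕ.* k) ℕ.≤ p ℕ.* p ℕ.* n
    InRange⇒ r = ι-cancel-≤ (subst₂ _≤_ x²-scaled c²n-scaled (*-monoʳ-≤-nonNeg (ι (k ℕ.* k)) {{ι-nonNeg (k ℕ.* k)}} r))

    InRange⇐ : X ℕ.* (k ℕ.* k) ℕ.≤ p ℕ.* p ℕ.* n → InRange c n x
    InRange⇐ le = *-cancelʳ-≤-pos (ι (k ℕ.* k)) {{ι-pos (k ℕ.* k)}} (subst₂ _≤_ (sym x²-scaled) (sym c²n-scaled) (ι-mono-≤ le))

-- From the integers z and x to the natural numbers w and a.

module Parametrisation where
  open import Defs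
  open import Data.Nat as ℕ using (ℕ; suc; _∸_; ⌊_/2⌋; ⌈_/2⌉; s≤s; z≤n)
  import Data.Nat.Properties as ℕ
  open import Data.Nat.DivMod using (m*n%n≡0; m*n/n≡m)
  open import Data.Nat.Combinatorics using (_C_; nCk≡nC[n∸k]; k>n⇒nCk≡0)
  open import Data.Integer hiding (suc)
  import Data.Integer as ℤ
  open import Data.Integer.Properties
  open import Data.Integer.DivMod using ([n/ℕd]*d≤n; n<s[n/ℕd]*d)
  open import Data.Integer.Tactic.RingSolver using (solve-∀)
  open import Data.Product using (_×_; _,_; ∃-syntax)
  open import Data.Sum using (_⊎_; inj₁; inj₂)
  open import Relation.Nullary using (yes; no)
  open import Relation.Binary.PropositionalEquality
  open BinomialBounds using (⌈n/2⌉≡⌊n/2⌋⊎1+⌊n/2⌋)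

  binomHalf-even : ∀ n k {i} → i ≡ + k * + 2 → binomHalf n i ≡ n C k
  binomHalf-even n k {i} eq = trans (cong (binomHalf n) (trans eq (sym (pos-* k 2)))) at-double
    where
    even : k ℕ.* 2 ℕ.% 2 ≡ 0
    even = m*n%n≡0 k 2
    half : k ℕ.* 2 ℕ./ 2 ≡ k
    half = m*n/n≡m k 2
    at-double : binomHalf n (+ (k ℕ.* 2)) ≡ n C k
    at-double rewrite even | half = refl

  binomHalf-neg : ∀ n k {i} → i ≡ - + suc k * + 2 → binomHalf n i ≡ 0
  binomHalf-neg n k refl = refl

  /ℕ-unique : ∀ i q d r .{{_ : ℕ.NonZero d}} → i ≡ + r + q * + d → r ℕ.< d → i /ℕ d ≡ q
  /ℕ-unique i q d@(suc _) r eq r<d = ≤-antisym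
    (<-suc⇒≤ (*-cancelʳ-<-nonNeg (+ d) (≤-<-trans ([n/ℕd]*d≤n i d) upper)))
    (<-suc⇒≤ (*-cancelʳ-<-nonNeg (+ d) (≤-<-trans lower (n<s[n/ℕd]*d i d))))
    where
    <-suc⇒≤ : ∀ {i j} → i < ℤ.suc j → i ≤ j
    <-suc⇒≤ {i} {j} lt = subst (i ≤_) (pred-suc j) (i<j⇒i≤pred[j] lt)
    open ≤-Reasoning
    lower : q * + d ≤ i
    lower = begin
      q * + d          ≡⟨ +-identityˡ (q * + d) ⟨
      0ℤ + q * + d     ≤⟨ +-monoˡ-≤ (q * + d) (+≤+ z≤n) ⟩
      + r + q * + d    ≡⟨ eq ⟨
      i                ∎
    upper : i < ℤ.suc q * + d
    upper = begin-strict
      i                ≡⟨ eq ⟩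
      + r + q * + d    <⟨ +-monoˡ-< (q * + d) (+<+ r<d) ⟩
      + d + q * + d    ≡⟨ suc-* q (+ d) ⟨
      ℤ.suc q * + d     ∎

  ceil4-unique : ∀ z q r → z ≡ q * + 4 - + r → r ℕ.< 4 → ceil4 z ≡ q
  ceil4-unique z q r eq r<4 = trans (cong -_ (/ℕ-unique (- z) (- q) 4 r (trans (cong -_ eq) (flip q (+ r))) r<4)) (neg-involutive q)
    where
    flip : ∀ q r → - (q * + 4 - r) ≡ r + - q * + 4
    flip = solve-∀

  +⌊/2⌋+⌈/2⌉ : ∀ w → + w ≡ + ⌊ w /2⌋ + + ⌈ w /2⌉
  +⌊/2⌋+⌈/2⌉ w = cong +_ (sym (ℕ.⌊n/2⌋+⌈n/2⌉≡n w))

  -- 2w falls short of the next multiple of 4 by 0 or 2, according to the parity of `w`.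
  ceil4-pos : ∀ w → ceil4 (+ w * + 2) ≡ + ⌈ w /2⌉
  ceil4-pos w with ⌈n/2⌉≡⌊n/2⌋⊎1+⌊n/2⌋ w
  ... | inj₁ e = ceil4-unique _ _ 0 (trans (cong (_* + 2) (+⌊/2⌋+⌈/2⌉ w))
          (subst (λ f → (+ ⌊ w /2⌋ + + f) * + 2 ≡ + f * + 4 - + 0) (sym e) (identity (+ ⌊ w /2⌋)))) (s≤s z≤n)
    where
    identity : ∀ f → (f + f) * + 2 ≡ f * + 4 - + 0
    identity = solve-∀
  ... | inj₂ e = ceil4-unique _ _ 2 (trans (cong (_* + 2) (+⌊/2⌋+⌈/2⌉ w))
          (subst (λ f → (+ ⌊ w /2⌋ + + f) * + 2 ≡ + f * + 4 - + 2) (sym e) (identity (+ ⌊ w /2⌋)))) (s≤s (s≤s (s≤s z≤n)))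
    where
    identity : ∀ f → (f + (+ 1 + f)) * + 2 ≡ (+ 1 + f) * + 4 - + 2
    identity = solve-∀

  ceil4-neg : ∀ w → ceil4 (- (+ w * + 2)) ≡ - + ⌊ w /2⌋
  ceil4-neg w with ⌈n/2⌉≡⌊n/2⌋⊎1+⌊n/2⌋ w
  ... | inj₁ e = ceil4-unique _ _ 0 (trans (cong (λ i → - (i * + 2)) (+⌊/2⌋+⌈/2⌉ w))
          (subst (λ f → - ((+ ⌊ w /2⌋ + + f) * + 2) ≡ - + ⌊ w /2⌋ * + 4 - + 0) (sym e) (identity (+ ⌊ w /2⌋)))) (s≤s z≤n)
    where
    identity : ∀ f → - ((f + f) * + 2) ≡ - f * + 4 - + 0
    identity = solve-∀
  ... | inj₂ e = ceil4-unique _ _ 2 (trans (cong (λ i → - (i * + 2)) (+⌊/2⌋+⌈/2⌉ w))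
          (subst (λ f → - ((+ ⌊ w /2⌋ + + f) * + 2) ≡ - + ⌊ w /2⌋ * + 4 - + 2) (sym e) (identity (+ ⌊ w /2⌋)))) (s≤s (s≤s (s≤s z≤n)))
    where
    identity : ∀ f → - ((f + (+ 1 + f)) * + 2) ≡ - f * + 4 - + 2
    identity = solve-∀

  numeratorProduct : ℕ → ℤ → ℤ → ℕ
  numeratorProduct n z x = binomHalf n (+ n - x) ℕ.* binomHalf n (+ n - z + x)

  ψBinomial : ℕ → ℤ → ℤ → ℕ
  ψBinomial n z x = binomHalf n (+ n - x + + 2 * ceil4 z)

  -- For z = 2w one has a = (n − x)/2, and for z = −2w one has a = (n − x)/2 − w: there the two
  -- binomials of the numerator trade places, and ⌈z/4⌉ = −⌊w/2⌋ yields the same binomial in ψ.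
  Parametrised : ℕ → ℕ → ℕ → ℤ → ℤ → Set
  Parametrised n w a z x =
    numeratorProduct n z x ≡ (n C a) ℕ.* (n C (a ℕ.+ w)) × ψBinomial n z x ≡ n C (a ℕ.+ ⌈ w /2⌉)

  -- The first alternative covers `x` outside the support of f, where no `a` exists and the upper
  -- bound on the numerator is trivial.
  Classified : ℕ → ℕ → ℤ → ℤ → Set
  Classified n w z x = numeratorProduct n z x ≡ 0 ⊎ ∃[ a ] Parametrised n w a z x

  -- In this form the second argument depends on `x` only through `+ n - x`, so a single equation
  -- for the latter fixes both binomials of the numerator.
  reflect : ∀ n z x → + n - z + x ≡ + n + + n - z - (+ n - x)
  reflect n z x = identity (+ n) z x
    where
    identity : ∀ n z x → n - z + x ≡ n + n - z - (n - x)
    identity = solve-∀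

  module Nonnegative-z (n w : ℕ) (x : ℤ) where
    z : ℤ
    z = + w * + 2

    parametrised : ∀ a → + n - x ≡ + a * + 2 → a ℕ.+ w ℕ.≤ n → Parametrised n w a z x
    parametrised a eq a+w≤n =
      cong₂ ℕ._*_ (binomHalf-even n a eq) (trans (binomHalf-even n b second) (sym (nCk≡nC[n∸k] a+w≤n))) ,
      binomHalf-even n (a ℕ.+ ⌈ w /2⌉) third
      where
      b = n ∸ (a ℕ.+ w)
      +n≡ : + n ≡ + a + + w + + b
      +n≡ = cong +_ (sym (ℕ.m+[n∸m]≡n a+w≤n))
      identity : ∀ a w b → a + w + b + (a + w + b) - w * + 2 - a * + 2 ≡ b * + 2
      identity = solve-∀
      second : + n - z + x ≡ + b * + 2
      second = trans (reflect n z x) (trans (cong₂ (λ i j → i + i - z - j) +n≡ eq) (identity (+ a) (+ w) (+ b)))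
      distrib : ∀ a h → a * + 2 + + 2 * h ≡ (a + h) * + 2
      distrib = solve-∀
      third : + n - x + + 2 * ceil4 z ≡ + (a ℕ.+ ⌈ w /2⌉) * + 2
      third = trans (cong₂ (λ i j → i + + 2 * j) eq (ceil4-pos w)) (distrib (+ a) (+ ⌈ w /2⌉))

    classify : ∀ j → + n - x ≡ j * + 2 → Classified n w z x
    classify -[1+ a ] eq = inj₁ (cong (ℕ._* binomHalf n (+ n - z + x)) (binomHalf-neg n a eq))
    classify (+ a) eq with a ℕ.+ w ℕ.≤? n
    ... | yes a+w≤n = inj₂ (a , parametrised a eq a+w≤n)
    ... | no  a+w≰n = inj₁ (trans (cong (binomHalf n (+ n - x) ℕ.*_) (binomHalf-neg n b second)) (ℕ.*-zeroʳ (binomHalf n (+ n - x))))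
      where
      b = a ℕ.+ w ∸ suc n
      a+w≡ : + a + + w ≡ + n + + suc b
      a+w≡ = cong +_ (trans (sym (ℕ.m+[n∸m]≡n (ℕ.≰⇒> a+w≰n))) (sym (ℕ.+-suc n b)))
      identity₁ : ∀ n w a → n + n - w * + 2 - a * + 2 ≡ (n + n) - (a + w) * + 2
      identity₁ = solve-∀
      identity₂ : ∀ n b → (n + n) - (n + b) * + 2 ≡ - b * + 2
      identity₂ = solve-∀
      second : + n - z + x ≡ - + suc b * + 2
      second = trans (reflect n z x) (trans (cong (λ j → + n + + n - z - j) eq)
        (trans (identity₁ (+ n) (+ w) (+ a)) (trans (cong (λ i → + n + + n - i * + 2) a+w≡) (identity₂ (+ n) (+ suc b)))))

    -- The bottom index is n - w; symmetry turns it into n + w, the index that z = -2w produces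
    -- directly.
    denominator : w ℕ.≤ n → binomHalf (2 ℕ.* n) (+ (2 ℕ.* n) - z) ≡ (2 ℕ.* n) C (n ℕ.+ w)
    denominator w≤n = trans (binomHalf-even (2 ℕ.* n) (n ∸ w) eq) (sym (trans (nCk≡nC[n∸k] n+w≤2n) (cong ((2 ℕ.* n) C_) 2n∸[n+w]≡n∸w)))
      where
      n+w≤2n : n ℕ.+ w ℕ.≤ 2 ℕ.* n
      n+w≤2n = ℕ.+-monoʳ-≤ n (ℕ.≤-trans w≤n (ℕ.m≤m+n n 0))
      2n∸[n+w]≡n∸w : 2 ℕ.* n ∸ (n ℕ.+ w) ≡ n ∸ w
      2n∸[n+w]≡n∸w = trans (ℕ.[m+n]∸[m+o]≡n∸o n (n ℕ.+ 0) w) (cong (_∸ w) (ℕ.+-identityʳ n))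
      +n≡ : + n ≡ + w + + (n ∸ w)
      +n≡ = cong +_ (sym (ℕ.m+[n∸m]≡n w≤n))
      identity : ∀ w m → + 2 * (w + m) - w * + 2 ≡ m * + 2
      identity = solve-∀
      eq : + (2 ℕ.* n) - z ≡ + (n ∸ w) * + 2
      eq = trans (cong (_- z) (trans (pos-* 2 n) (cong (+ 2 *_) +n≡))) (identity (+ w) (+ (n ∸ w)))

  module Nonpositive-z (n w : ℕ) (x : ℤ) where
    z : ℤ
    z = - (+ w * + 2)

    parametrised : ∀ a → + n - x ≡ + (a ℕ.+ w) * + 2 → a ℕ.≤ n → Parametrised n w a z x
    parametrised a eq a≤n =
      trans (cong₂ ℕ._*_ (binomHalf-even n (a ℕ.+ w) eq) (trans (binomHalf-even n b second) (sym (nCk≡nC[n∸k] a≤n))))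
        (ℕ.*-comm (n C (a ℕ.+ w)) (n C a)) ,
      binomHalf-even n (a ℕ.+ ⌈ w /2⌉) third
      where
      b = n ∸ a
      +n≡ : + n ≡ + a + + b
      +n≡ = cong +_ (sym (ℕ.m+[n∸m]≡n a≤n))
      identity : ∀ a w b → a + b + (a + b) - - (w * + 2) - (a + w) * + 2 ≡ b * + 2
      identity = solve-∀
      second : + n - z + x ≡ + b * + 2
      second = trans (reflect n z x) (trans (cong₂ (λ i j → i + i - z - j) +n≡ eq) (identity (+ a) (+ w) (+ b)))
      distrib : ∀ a f h → (a + (f + h)) * + 2 + + 2 * (- f) ≡ (a + h) * + 2
      distrib = solve-∀
      third : + n - x + + 2 * ceil4 z ≡ + (a ℕ.+ ⌈ w /2⌉) * + 2
      third = trans (cong₂ (λ i j → i + + 2 * j) (trans eq (cong (λ i → (+ a + i) * + 2) (+⌊/2⌋+⌈/2⌉ w))) (ceil4-neg w))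
        (distrib (+ a) (+ ⌊ w /2⌋) (+ ⌈ w /2⌉))

    -- Now j = (n - x)/2 plays the role of a + w. For j < w the second binomial vanishes because its
    -- index n + w - j exceeds `n`, not because it is negative.
    classify : ∀ j → + n - x ≡ j * + 2 → Classified n w z x
    classify -[1+ a ] eq = inj₁ (cong (ℕ._* binomHalf n (+ n - z + x)) (binomHalf-neg n a eq))
    classify (+ a′) eq with a′ ℕ.≤? n | w ℕ.≤? a′
    ... | no a′≰n | _ = inj₁ (cong (ℕ._* binomHalf n (+ n - z + x)) (trans (binomHalf-even n a′ eq) (k>n⇒nCk≡0 (ℕ.≰⇒> a′≰n))))
    ... | yes a′≤n | yes w≤a′ = inj₂ (a′ ∸ w , parametrised (a′ ∸ w) (trans eq (cong (λ i → + i * + 2) (sym (ℕ.m∸n+n≡m w≤a′)))) (ℕ.≤-trans (ℕ.m∸n≤m a′ w) a′≤n))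
    ... | yes a′≤n | no w≰a′ = inj₁ (trans (cong (binomHalf n (+ n - x) ℕ.*_) (trans (binomHalf-even n (suc (n ℕ.+ b)) second) (k>n⇒nCk≡0 (s≤s (ℕ.m≤m+n n b))))) (ℕ.*-zeroʳ (binomHalf n (+ n - x))))
      where
      b = w ∸ suc a′
      +w≡ : + w ≡ + a′ + + suc b
      +w≡ = cong +_ (trans (sym (ℕ.m+[n∸m]≡n (ℕ.≰⇒> w≰a′))) (sym (ℕ.+-suc a′ b)))
      identity : ∀ n a b → n + n - - ((a + b) * + 2) - a * + 2 ≡ (n + b) * + 2
      identity = solve-∀
      second : + n - z + x ≡ + suc (n ℕ.+ b) * + 2
      second = trans (reflect n z x) (trans (cong₂ (λ i j → + n + + n - - (i * + 2) - j) +w≡ eq)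
        (trans (identity (+ n) (+ a′) (+ suc b)) (cong (λ i → + i * + 2) (ℕ.+-suc n b))))

    denominator : binomHalf (2 ℕ.* n) (+ (2 ℕ.* n) - z) ≡ (2 ℕ.* n) C (n ℕ.+ w)
    denominator = binomHalf-even (2 ℕ.* n) (n ℕ.+ w) (trans (cong (_- z) (pos-* 2 n)) (identity (+ n) (+ w)))
      where
      identity : ∀ n w → + 2 * n - - (w * + 2) ≡ (n + w) * + 2
      identity = solve-∀

-- The ratio as a fraction of natural numbers.

module RatioLimit where
  open import Defs
  open import Data.Nat as ℕ using (ℕ; suc; zero; _∸_; ⌊_/2⌋; ⌈_/2⌉)
  import Data.Nat.Properties as ℕ
  open import Data.Nat.Combinatorics using (_C_)
  open import Data.Nat.DivMod using (m*n%n≡0)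
  import Data.Nat.Divisibility as ℕ
  import Data.Nat.Tactic.RingSolver as ℕ-Solver
  open import Data.Integer as ℤ using (ℤ; +_; -[1+_]; _%ℕ_; _/ℕ_)
  import Data.Integer.Properties as ℤ
  open import Data.Integer.DivMod using (a≡a%ℕn+[a/ℕn]*n; div-pos-is-/ℕ)
  import Data.Integer.Tactic.RingSolver as ℤ-Solver
  open import Data.Integer.Divisibility using (_∣_)
  open import Data.Rational as ℚ using (ℚ; 0ℚ; _+_; _*_; -_; _≤_; _<_; _/_; mkℚ; 1/_; _÷_; _⊔_)
  open import Data.Rational.Properties
  open import Data.Rational.Solver using (module +-*-Solver)
  open import Data.List using ([]; _∷_; foldr)
  open import Data.List.Membership.Propositional using (_∈_)
  open import Data.List.Membership.Propositional.Properties using (∈-map⁺; ∈-upTo⁺; ∈-filter⁺; ∈-filter⁻)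
  open import Data.List.Relation.Unary.Any using (here; there)
  open import Data.Product using (_×_; _,_; proj₁; proj₂; ∃-syntax)
  open import Data.Sum using (_⊎_; inj₁; inj₂)
  open import Data.Empty using (⊥-elim)
  open import Relation.Nullary using (yes; no)
  open import Relation.Nullary.Decidable using (_×-dec_)
  open import Relation.Unary using (Decidable)
  open import Relation.Binary.PropositionalEquality
  open BinomialBounds
  open RationalBounds
  open Parametrisation

  fBinomial : ℕ → ℤ → ℕ
  fBinomial n z = binomHalf (2 ℕ.* n) (+ (2 ℕ.* n) ℤ.- z)

  f-scaled : ∀ n z x → fBinomial n z ≢ 0 → f n z x * ι (fBinomial n z) ≡ ι (numeratorProduct n z x)
  f-scaled n z x D≢0 with binomHalf (2 ℕ.* n) (+ (2 ℕ.* n) ℤ.- z)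
  ... | zero  = ⊥-elim (D≢0 refl)
  ... | suc d = /-*-cancel (numeratorProduct n z x) (suc d)

  ψ-scaled : ∀ n z x → ψ n z x * ι (2 ℕ.^ n) ≡ ι (ψBinomial n z x)
  ψ-scaled n z x = /-*-cancel (ψBinomial n z x) (2 ℕ.^ n) {{ℕ.m^n≢0 2 n}}

  -- A view of `ratio` that spares later proofs its `with`, under which the nonvanishing of ψ occurs
  -- as an instance.
  ratio-cases : ∀ n z x → (ψ n z x ≡ 0ℚ × ratio n z x ≡ 0ℚ)
    ⊎ (∃[ ψ≢0 ] ratio n z x ≡ (f n z x ÷ ψ n z x) {{ℚ.≢-nonZero ψ≢0}})
  ratio-cases n z x with ψ n z x ≟ 0ℚ
  ... | yes ψ≡0 = inj₁ (ψ≡0 , refl)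
  ... | no  ψ≢0 = inj₂ (ψ≢0 , refl)

  ÷-*-cancel : ∀ p q .{{_ : ℚ.NonZero q}} → (p ÷ q) * q ≡ p
  ÷-*-cancel p q = begin
    p * 1/ q * q      ≡⟨ *-assoc p (1/ q) q ⟩
    p * (1/ q * q)    ≡⟨ cong (p *_) (*-inverseˡ q) ⟩
    p * ℚ.1ℚ          ≡⟨ *-identityʳ p ⟩
    p                 ∎
    where open ≡-Reasoning

  ψ≡0⇒ψBinomial≡0 : ∀ n z x → ψ n z x ≡ 0ℚ → ψBinomial n z x ≡ 0
  ψ≡0⇒ψBinomial≡0 n z x ψ≡0 = ℕ.n≤0⇒n≡0 (ι-cancel-≤ (≤-reflexive ιM≡0))
    where
    ιM≡0 : ι (ψBinomial n z x) ≡ ι 0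
    ιM≡0 = trans (sym (ψ-scaled n z x)) (trans (cong (_* ι (2 ℕ.^ n)) ψ≡0) (*-zeroˡ (ι (2 ℕ.^ n))))

  ψBinomial≡0⇒ψ≡0 : ∀ n z x → ψBinomial n z x ≡ 0 → ψ n z x ≡ 0ℚ
  ψBinomial≡0⇒ψ≡0 n z x M≡0 = trans (cong (λ m → (+ m / (2 ℕ.^ n)) {{2^n≢0}}) M≡0) (0/n≡0 (2 ℕ.^ n) {{2^n≢0}})
    where 2^n≢0 = ℕ.m^n≢0 2 n

  ratio*ψ≡f : ∀ n z x → ψBinomial n z x ≢ 0 → ratio n z x * ψ n z x ≡ f n z x
  ratio*ψ≡f n z x M≢0 = by-cases (ratio-cases n z x)
    where
    by-cases : (ψ n z x ≡ 0ℚ × ratio n z x ≡ 0ℚ) ⊎ (∃[ ψ≢0 ] ratio n z x ≡ (f n z x ÷ ψ n z x) {{ℚ.≢-nonZero ψ≢0}}) →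
      ratio n z x * ψ n z x ≡ f n z x
    by-cases (inj₁ (ψ≡0 , _))  = ⊥-elim (M≢0 (ψ≡0⇒ψBinomial≡0 n z x ψ≡0))
    by-cases (inj₂ (ψ≢0 , eq)) = trans (cong (_* ψ n z x) eq) (÷-*-cancel (f n z x) (ψ n z x) {{ℚ.≢-nonZero ψ≢0}})

  ratio-scaled : ∀ n z x → fBinomial n z ≢ 0 → ψBinomial n z x ≢ 0 →
    ratio n z x * ι (fBinomial n z ℕ.* ψBinomial n z x) ≡ ι (2 ℕ.^ n ℕ.* numeratorProduct n z x)
  ratio-scaled n z x D≢0 M≢0 = begin
    q * ι (D ℕ.* M)                        ≡⟨ cong (q *_) (ι-* D M) ⟩
    q * (ι D * ι M)                        ≡⟨ cong (λ m → q * (ι D * m)) (ψ-scaled n z x) ⟨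
    q * (ι D * (ψ n z x * ι (2 ℕ.^ n)))    ≡⟨ solve 4 (λ q d p t → q :* (d :* (p :* t)) := t :* (q :* p :* d)) refl q (ι D) (ψ n z x) (ι (2 ℕ.^ n)) ⟩
    ι (2 ℕ.^ n) * (q * ψ n z x * ι D)      ≡⟨ cong (λ r → ι (2 ℕ.^ n) * (r * ι D)) (ratio*ψ≡f n z x M≢0) ⟩
    ι (2 ℕ.^ n) * (f n z x * ι D)          ≡⟨ cong (ι (2 ℕ.^ n) *_) (f-scaled n z x D≢0) ⟩
    ι (2 ℕ.^ n) * ι (numeratorProduct n z x) ≡⟨ ι-* (2 ℕ.^ n) (numeratorProduct n z x) ⟨
    ι (2 ℕ.^ n ℕ.* numeratorProduct n z x) ∎
    where
    open ≡-Reasoning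
    open +-*-Solver
    q = ratio n z x
    D = fBinomial n z
    M = ψBinomial n z x

  module _ (n w : ℕ) (z : ℤ) (ε : ℚ) (e d : ℕ) (1≤n : 1 ℕ.≤ n) (w≤n : w ℕ.≤ n) (D≡ : fBinomial n z ≡ (2 ℕ.* n) C (n ℕ.+ w))
    (0<ε : 0ℚ < ε) (1≤e : 1 ℕ.≤ e) (1≤d : 1 ℕ.≤ d) (εd≡e : ε * ι d ≡ ι e) where

    private
      D>0 : 0 ℕ.< fBinomial n z
      D>0 = subst (0 ℕ.<_) (sym D≡) (k≤n⇒nCk>0 (ℕ.+-monoʳ-≤ n (ℕ.≤-trans w≤n (ℕ.m≤m+n n 0))))

    0-below-√2+ε : BelowSqrt2+ 0ℚ ε
    0-below-√2+ε = inj₁ (<-respˡ-≡ (sym (+-identityˡ (- ε))) (neg-antimono-< 0<ε))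

    ratio-below : ∀ x → (16 ℕ.* (d ℕ.* d) ℕ.+ 1) ℕ.* w ℕ.≤ n →
      Classified n w z x → BelowSqrt2+ (ratio n z x) ε
    ratio-below x tw≤n cases = by-cases (ratio-cases n z x)
      where
      P = 2 ℕ.^ n ℕ.* numeratorProduct n z x
      Q = fBinomial n z ℕ.* ψBinomial n z x
      squared : Classified n w z x →
        P ℕ.* P ℕ.* ((n ∸ w) ℕ.* (n ∸ w)) ℕ.≤ 2 ℕ.* ((n ℕ.+ w) ℕ.* (n ℕ.+ w)) ℕ.* (Q ℕ.* Q)
      squared (inj₁ N≡0) = subst (λ p → p ℕ.* p ℕ.* ((n ∸ w) ℕ.* (n ∸ w)) ℕ.≤ 2 ℕ.* ((n ℕ.+ w) ℕ.* (n ℕ.+ w)) ℕ.* (Q ℕ.* Q))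
        (sym (trans (cong (2 ℕ.^ n ℕ.*_) N≡0) (ℕ.*-zeroʳ (2 ℕ.^ n)))) ℕ.z≤n
      squared (inj₂ (a , N≡ , M≡)) =
        subst₂ (λ p q → p ℕ.* p ℕ.* ((n ∸ w) ℕ.* (n ∸ w)) ℕ.≤ 2 ℕ.* ((n ℕ.+ w) ℕ.* (n ℕ.+ w)) ℕ.* (q ℕ.* q))
          (cong (2 ℕ.^ n ℕ.*_) (sym N≡)) (cong₂ ℕ._*_ (sym D≡) (sym M≡)) (RatioBounds.ratio²-upper n w a 1≤n)
      nondegenerate : ψBinomial n z x ≢ 0 → BelowSqrt2+ (ratio n z x) ε
      nondegenerate M≢0 = below-√2+ε (ratio n z x) ε 0<ε
        (q²<2+ε² (ratio n z x) ε P Q e d (ratio-scaled n z x (ℕ.>⇒≢ D>0) M≢0) εd≡e 1≤e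
          (near-2-upper {n} {w} {P} {Q} {d} 1≤n 1≤d (ℕ.*-mono-≤ D>0 (ℕ.n≢0⇒n>0 M≢0)) tw≤n (squared cases)))
      by-cases : (ψ n z x ≡ 0ℚ × ratio n z x ≡ 0ℚ) ⊎ (∃[ ψ≢0 ] ratio n z x ≡ (f n z x ÷ ψ n z x) {{ℚ.≢-nonZero ψ≢0}}) →
        BelowSqrt2+ (ratio n z x) ε
      -- Where ψ vanishes the ratio is 0 by convention, and 0 - ε is negative.
      by-cases (inj₁ (_ , ratio≡0)) = subst (λ q → BelowSqrt2+ q ε) (sym ratio≡0) 0-below-√2+ε
      by-cases (inj₂ (ψ≢0 , _)) = nondegenerate λ M≡0 → ψ≢0 (ψBinomial≡0⇒ψ≡0 n z x M≡0)

    ratio-above : ∀ x a b → 3 ℕ.* (d ℕ.* d) ℕ.≤ n → Parametrised n w a z x →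
      a ℕ.+ b ℕ.+ w ≡ n → a ℕ.≤ suc b → b ℕ.≤ suc a → a ℕ.+ ⌊ w /2⌋ ≡ ⌊ n /2⌋ →
      0ℚ ≤ ratio n z x × ι 2 < ratio n z x * ratio n z x + ε * ε
    ratio-above x a b 3d²≤n (N≡ , M≡) a+b+w≡n a≤1+b b≤1+a mid = 0≤ratio ,
      2<q²+ε² (ratio n z x) ε P Q e d scaled εd≡e 1≤e (near-2-lower {n} {P} {Q} {d} 3d²≤n Q>0 squared)
      where
      P = 2 ℕ.^ n ℕ.* numeratorProduct n z x
      Q = fBinomial n z ℕ.* ψBinomial n z x
      a+⌈w/2⌉≤n : a ℕ.+ ⌈ w /2⌉ ℕ.≤ n
      a+⌈w/2⌉≤n = ℕ.≤-trans (ℕ.+-mono-≤ (ℕ.m≤m+n a b) (ℕ.⌈n/2⌉≤n w)) (ℕ.≤-reflexive a+b+w≡n)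
      M>0 : 0 ℕ.< ψBinomial n z x
      M>0 = subst (0 ℕ.<_) (sym M≡) (k≤n⇒nCk>0 a+⌈w/2⌉≤n)
      Q>0 : 0 ℕ.< Q
      Q>0 = ℕ.*-mono-≤ D>0 M>0
      scaled : ratio n z x * ι Q ≡ ι P
      scaled = ratio-scaled n z x (ℕ.>⇒≢ D>0) (ℕ.>⇒≢ M>0)
      0≤ratio : 0ℚ ≤ ratio n z x
      0≤ratio = *-cancelʳ-≤-pos (ι Q) {{ι-pos Q {{ℕ.>-nonZero Q>0}}}}
        (subst₂ _≤_ (sym (*-zeroˡ (ι Q))) (sym scaled) (ι-mono-≤ {0} {P} ℕ.z≤n))
      squared : (2 ℕ.* n ℕ.+ 1) ℕ.* (Q ℕ.* Q) ℕ.≤ (n ℕ.+ 2) ℕ.* (P ℕ.* P)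
      squared = subst₂ (λ p q → (2 ℕ.* n ℕ.+ 1) ℕ.* (q ℕ.* q) ℕ.≤ (n ℕ.+ 2) ℕ.* (p ℕ.* p))
        (cong (2 ℕ.^ n ℕ.*_) (sym N≡)) (cong₂ ℕ._*_ (sym D≡) (sym M≡))
        (RatioBounds.ratio²-lower n w a b a+b+w≡n a≤1+b b≤1+a mid)

  -- The maximum over the admissible x.

  module _ {A : Set} (g : A → ℚ) where
    -- `⊔` returns one of its arguments, so any property of all entries and of the start value
    -- passes to the maximum, without monotonicity of `P`.
    foldr-⊔-preserves : (P : ℚ → Set) → P 0ℚ → ∀ xs → (∀ {x} → x ∈ xs → P (g x)) → P (foldr (λ x m → g x ⊔ m) 0ℚ xs)
    foldr-⊔-preserves P P0 []       _   = P0
    foldr-⊔-preserves P P0 (x ∷ xs) all with ⊔-sel (g x) (foldr (λ x m → g x ⊔ m) 0ℚ xs)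
    ... | inj₁ eq = subst P (sym eq) (all (here refl))
    ... | inj₂ eq = subst P (sym eq) (foldr-⊔-preserves P P0 xs (λ x∈xs → all (there x∈xs)))

    ≤-foldr-⊔ : ∀ {x} xs → x ∈ xs → g x ≤ foldr (λ x m → g x ⊔ m) 0ℚ xs
    ≤-foldr-⊔ (y ∷ xs) (here refl)   = p≤p⊔q (g y) _
    ≤-foldr-⊔ (y ∷ xs) (there x∈xs) = ≤-trans (≤-foldr-⊔ xs x∈xs) (p≤q⊔p (g y) _)

  ∈-intsUpTo : ∀ B x → ℤ.∣ x ∣ ℕ.≤ B → x ∈ intsUpTo B
  ∈-intsUpTo B (+ m) m≤B = subst (_∈ intsUpTo B) (cancel (+ m) (+ B))
    (∈-map⁺ (λ i → + i ℤ.- + B) (∈-upTo⁺ {i = m ℕ.+ B} (ℕ.s≤s (ℕ.+-mono-≤ m≤B (ℕ.m≤m+n B 0)))))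
    where
    cancel : ∀ m B → m ℤ.+ B ℤ.- B ≡ m
    cancel = ℤ-Solver.solve-∀
  ∈-intsUpTo B -[1+ m ] m<B = subst (_∈ intsUpTo B)
    (trans (cong (λ b → + (B ∸ suc m) ℤ.- + b) (sym (ℕ.m∸n+n≡m m<B))) (cancel (+ (B ∸ suc m)) (+ suc m)))
    (∈-map⁺ (λ i → + i ℤ.- + B) (∈-upTo⁺ {i = B ∸ suc m} (ℕ.s≤s (ℕ.≤-trans (ℕ.m∸n≤m B (suc m)) (ℕ.m≤m+n B (B ℕ.+ 0))))))
    where
    cancel : ∀ i s → i ℤ.- (i ℤ.+ s) ≡ ℤ.- s
    cancel = ℤ-Solver.solve-∀

  -- Makes the search window at least [-n, n]. A ceiling of 0 would give a negative integer quotient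
  -- 0 on division, hence equality with its own nonnegative remainder.
  ∣⌈c⌉∣≥1 : ∀ c → 0ℚ < c → 1 ℕ.≤ ℤ.∣ ℚ.⌈ c ⌉ ∣
  ∣⌈c⌉∣≥1 (mkℚ (+ zero) d _) 0<c with drop-*<* 0<c
  ... | ℤ.+<+ ()
  ∣⌈c⌉∣≥1 (mkℚ -[1+ m ] d _) 0<c with drop-*<* 0<c
  ... | ()
  ∣⌈c⌉∣≥1 (mkℚ (+ suc m) d _) _ = ℕ.n≢0⇒n>0 λ ∣⌈c⌉∣≡0 →
    absurd (trans (sym (div-pos-is-/ℕ -[1+ m ] (suc d)))
      (ℤ.neg-injective (ℤ.∣i∣≡0⇒i≡0 ∣⌈c⌉∣≡0)))
    where
    absurd : -[1+ m ] /ℕ suc d ≢ + 0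
    absurd q≡0 with trans (a≡a%ℕn+[a/ℕn]*n -[1+ m ] (suc d)) (cong (λ q → + (-[1+ m ] %ℕ suc d) ℤ.+ q ℤ.* + suc d) q≡0)
    ... | ()

  admissible? : ∀ c n → Decidable (λ x → InRange c n x × SameParity n x)
  admissible? c n x = (toℚ (x ℤ.* x) ≤? c * c * ι n) ×-dec ((+ n ℤ.- x) %ℕ 2 ℕ.≟ 0)

  ∈-admissible : ∀ c n x → 0ℚ < c → InRange c n x → SameParity n x → ℤ.∣ x ∣ ℕ.≤ n → x ∈ admissible c n
  ∈-admissible c n x 0<c range parity ∣x∣≤n = ∈-filter⁺ (admissible? c n)
    (∈-intsUpTo _ x (ℕ.≤-trans ∣x∣≤n (ℕ.m≤n*m n ℤ.∣ ℚ.⌈ c ⌉ ∣ {{ℕ.>-nonZero (∣⌈c⌉∣≥1 c 0<c)}})))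
    (range , parity)

  ∈-admissible⇒SameParity : ∀ c n {x} → x ∈ admissible c n → SameParity n x
  ∈-admissible⇒SameParity c n x∈ = proj₂ (proj₂ (∈-filter⁻ (admissible? c n) {xs = intsUpTo (ℤ.∣ ℚ.⌈ c ⌉ ∣ ℕ.* n)} x∈))

  SameParity⇒double : ∀ n x → SameParity n x → + n ℤ.- x ≡ (+ n ℤ.- x) /ℕ 2 ℤ.* + 2
  SameParity⇒double n x parity = trans (a≡a%ℕn+[a/ℕn]*n (+ n ℤ.- x) 2)
    (trans (cong (λ r → + r ℤ.+ (+ n ℤ.- x) /ℕ 2 ℤ.* + 2) parity) (ℤ.+-identityˡ _))

  square-cancel-≤ : ∀ {m n} → m ℕ.* m ℕ.≤ n ℕ.* n → m ℕ.≤ n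
  square-cancel-≤ {m} {n} m²≤n² with m ℕ.≤? n
  ... | yes m≤n = m≤n
  ... | no  m≰n = ⊥-elim (ℕ.<⇒≱ (ℕ.*-mono-< (ℕ.≰⇒> m≰n) (ℕ.≰⇒> m≰n)) m²≤n²)

  -- The central x, where the lower bound is attained.

  module Centre {n w : ℕ} (w≤n : w ℕ.≤ n) where
    -- `a` is forced by a + ⌊w/2⌋ = ⌊n/2⌋, and then `b` by a + b + w = n. `δ` is the parity of `n`.
    a b δ : ℕ
    a = ⌊ n /2⌋ ∸ ⌊ w /2⌋
    b = ⌈ n /2⌉ ∸ ⌈ w /2⌉
    δ = ⌈ n /2⌉ ∸ ⌊ n /2⌋

    a+⌊w/2⌋≡⌊n/2⌋ : a ℕ.+ ⌊ w /2⌋ ≡ ⌊ n /2⌋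
    a+⌊w/2⌋≡⌊n/2⌋ = ℕ.m∸n+n≡m (ℕ.⌊n/2⌋-mono w≤n)

    b+⌈w/2⌉≡⌈n/2⌉ : b ℕ.+ ⌈ w /2⌉ ≡ ⌈ n /2⌉
    b+⌈w/2⌉≡⌈n/2⌉ = ℕ.m∸n+n≡m (ℕ.⌈n/2⌉-mono w≤n)

    a+⌊w/2⌋+δ≡⌈n/2⌉ : a ℕ.+ ⌊ w /2⌋ ℕ.+ δ ≡ ⌈ n /2⌉
    a+⌊w/2⌋+δ≡⌈n/2⌉ = trans (cong (ℕ._+ δ) a+⌊w/2⌋≡⌊n/2⌋) (ℕ.m+[n∸m]≡n (ℕ.⌊n/2⌋≤⌈n/2⌉ n))

    a+b+w≡n : a ℕ.+ b ℕ.+ w ≡ n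
    a+b+w≡n = begin
      a ℕ.+ b ℕ.+ w                                ≡⟨ cong (a ℕ.+ b ℕ.+_) (ℕ.⌊n/2⌋+⌈n/2⌉≡n w) ⟨
      a ℕ.+ b ℕ.+ (⌊ w /2⌋ ℕ.+ ⌈ w /2⌉)            ≡⟨ swap a b ⌊ w /2⌋ ⌈ w /2⌉ ⟩
      (a ℕ.+ ⌊ w /2⌋) ℕ.+ (b ℕ.+ ⌈ w /2⌉)          ≡⟨ cong₂ ℕ._+_ a+⌊w/2⌋≡⌊n/2⌋ b+⌈w/2⌉≡⌈n/2⌉ ⟩
      ⌊ n /2⌋ ℕ.+ ⌈ n /2⌉                          ≡⟨ ℕ.⌊n/2⌋+⌈n/2⌉≡n n ⟩
      n                                            ∎
      where
      open ≡-Reasoning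
      swap : ∀ a b f h → a ℕ.+ b ℕ.+ (f ℕ.+ h) ≡ (a ℕ.+ f) ℕ.+ (b ℕ.+ h)
      swap = ℕ-Solver.solve-∀

    a+w≤n : a ℕ.+ w ℕ.≤ n
    a+w≤n = ℕ.≤-trans (ℕ.+-monoˡ-≤ w (ℕ.m≤m+n a b)) (ℕ.≤-reflexive a+b+w≡n)

    a≤1+b : a ℕ.≤ suc b
    a≤1+b = ℕ.+-cancelʳ-≤ ⌈ w /2⌉ a (suc b) (begin
      a ℕ.+ ⌈ w /2⌉          ≤⟨ ℕ.+-monoʳ-≤ a (⌈n/2⌉≤1+⌊n/2⌋ w) ⟩
      a ℕ.+ suc ⌊ w /2⌋      ≡⟨ ℕ.+-suc a ⌊ w /2⌋ ⟩
      suc (a ℕ.+ ⌊ w /2⌋)    ≡⟨ cong suc a+⌊w/2⌋≡⌊n/2⌋ ⟩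
      suc ⌊ n /2⌋            ≤⟨ ℕ.s≤s (ℕ.⌊n/2⌋≤⌈n/2⌉ n) ⟩
      suc ⌈ n /2⌉            ≡⟨ cong suc b+⌈w/2⌉≡⌈n/2⌉ ⟨
      suc b ℕ.+ ⌈ w /2⌉      ∎)
      where open ℕ.≤-Reasoning

    b≤1+a : b ℕ.≤ suc a
    b≤1+a = ℕ.+-cancelʳ-≤ ⌈ w /2⌉ b (suc a) (begin
      b ℕ.+ ⌈ w /2⌉          ≡⟨ b+⌈w/2⌉≡⌈n/2⌉ ⟩
      ⌈ n /2⌉                ≤⟨ ⌈n/2⌉≤1+⌊n/2⌋ n ⟩
      suc ⌊ n /2⌋            ≡⟨ cong suc a+⌊w/2⌋≡⌊n/2⌋ ⟨
      suc a ℕ.+ ⌊ w /2⌋      ≤⟨ ℕ.+-monoʳ-≤ (suc a) (ℕ.⌊n/2⌋≤⌈n/2⌉ w) ⟩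
      suc a ℕ.+ ⌈ w /2⌉      ∎)
      where open ℕ.≤-Reasoning

    δ≤1 : δ ℕ.≤ 1
    δ≤1 = ℕ.m≤n+o⇒m∸n≤o ⌈ n /2⌉ ⌊ n /2⌋ (ℕ.≤-trans (⌈n/2⌉≤1+⌊n/2⌋ n) (ℕ.≤-reflexive (ℕ.+-comm 1 ⌊ n /2⌋)))

    +n≡ : + n ≡ + a ℤ.+ + ⌊ w /2⌋ ℤ.+ (+ a ℤ.+ + ⌊ w /2⌋ ℤ.+ + δ)
    +n≡ = cong +_ (trans (sym (ℕ.⌊n/2⌋+⌈n/2⌉≡n n)) (sym (cong₂ ℕ._+_ a+⌊w/2⌋≡⌊n/2⌋ a+⌊w/2⌋+δ≡⌈n/2⌉)))

    -- These are n - 2a for z = 2w and n - 2(a + w) for z = -2w. Each lies within 1 of z/2.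
    x⁺ x⁻ : ℤ
    x⁺ = + δ ℤ.+ (+ ⌊ w /2⌋ ℤ.+ + ⌊ w /2⌋)
    x⁻ = + δ ℤ.- (+ ⌈ w /2⌉ ℤ.+ + ⌈ w /2⌉)

    n-x⁺ : + n ℤ.- x⁺ ≡ + a ℤ.* + 2
    n-x⁺ = trans (cong (ℤ._- x⁺) +n≡) (identity (+ a) (+ ⌊ w /2⌋) (+ δ))
      where
      identity : ∀ a f δ → a ℤ.+ f ℤ.+ (a ℤ.+ f ℤ.+ δ) ℤ.- (δ ℤ.+ (f ℤ.+ f)) ≡ a ℤ.* + 2
      identity = ℤ-Solver.solve-∀

    n-x⁻ : + n ℤ.- x⁻ ≡ + (a ℕ.+ w) ℤ.* + 2
    n-x⁻ = trans (cong (ℤ._- x⁻) +n≡) (trans (identity (+ a) (+ ⌊ w /2⌋) (+ ⌈ w /2⌉) (+ δ))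
      (cong (λ i → (+ a ℤ.+ i) ℤ.* + 2) (sym (+⌊/2⌋+⌈/2⌉ w))))
      where
      identity : ∀ a f h δ → a ℤ.+ f ℤ.+ (a ℤ.+ f ℤ.+ δ) ℤ.- (δ ℤ.- (h ℤ.+ h)) ≡ (a ℤ.+ (f ℤ.+ h)) ℤ.* + 2
      identity = ℤ-Solver.solve-∀

    ∣x⁺∣≤1+w : ℤ.∣ x⁺ ∣ ℕ.≤ suc w
    ∣x⁺∣≤1+w = ℕ.+-mono-≤ δ≤1 (ℕ.≤-trans (ℕ.+-monoʳ-≤ ⌊ w /2⌋ (ℕ.⌊n/2⌋≤⌈n/2⌉ w)) (ℕ.≤-reflexive (ℕ.⌊n/2⌋+⌈n/2⌉≡n w)))

    ∣x⁻∣≤1+w : ℤ.∣ x⁻ ∣ ℕ.≤ suc w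
    ∣x⁻∣≤1+w = begin
      ℤ.∣ x⁻ ∣                               ≡⟨ cong ℤ.∣_∣ (ℤ.m-n≡m⊖n δ (⌈ w /2⌉ ℕ.+ ⌈ w /2⌉)) ⟩
      ℤ.∣ δ ℤ.⊖ (⌈ w /2⌉ ℕ.+ ⌈ w /2⌉) ∣      ≤⟨ ℤ.∣m⊝n∣≤m⊔n δ (⌈ w /2⌉ ℕ.+ ⌈ w /2⌉) ⟩
      δ ℕ.⊔ (⌈ w /2⌉ ℕ.+ ⌈ w /2⌉)            ≤⟨ ℕ.⊔-lub (ℕ.≤-trans δ≤1 (ℕ.s≤s ℕ.z≤n)) (ℕ.≤-trans (ℕ.+-monoˡ-≤ ⌈ w /2⌉ (⌈n/2⌉≤1+⌊n/2⌋ w)) (ℕ.≤-reflexive (cong suc (ℕ.⌊n/2⌋+⌈n/2⌉≡n w)))) ⟩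
      suc w                                  ∎
      where open ℕ.≤-Reasoning

  double⇒SameParity : ∀ n x m → + n ℤ.- x ≡ + m ℤ.* + 2 → SameParity n x
  double⇒SameParity n x m eq = trans (cong (_%ℕ 2) (trans eq (sym (ℤ.pos-* m 2)))) (m*n%n≡0 m 2)

  double : ∀ z → (+ 2) ∣ z → ∃[ w ] (z ≡ + w ℤ.* + 2 ⊎ z ≡ ℤ.- (+ w ℤ.* + 2))
  double (+ m)    (ℕ.divides w eq) = w , inj₁ (trans (cong +_ eq) (ℤ.pos-* w 2))
  double -[1+ m ] (ℕ.divides w eq) = w , inj₂ (cong ℤ.-_ (trans (cong +_ eq) (ℤ.pos-* w 2)))

  ∣double∣ : ∀ {z} w → z ≡ + w ℤ.* + 2 ⊎ z ≡ ℤ.- (+ w ℤ.* + 2) → ℤ.∣ z ∣ ≡ w ℕ.* 2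
  ∣double∣ w (inj₁ refl) = ℤ.abs-* (+ w) (+ 2)
  ∣double∣ w (inj₂ refl) = trans (ℤ.∣-i∣≡∣i∣ (+ w ℤ.* + 2)) (ℤ.abs-* (+ w) (+ 2))

  -- How large n has to be, for c = p/k and ε with denominator d.

  module Threshold (p k d : ℕ) where
    t threshold : ℕ
    t = 16 ℕ.* (d ℕ.* d) ℕ.+ 1
    -- One summand per demand: k² ≤ n puts x = ±1 in range, p²t² ≤ n gives tw ≤ n for
    -- `near-2-upper`, and 3d² ≤ n is for `near-2-lower`.
    threshold = k ℕ.* k ℕ.+ p ℕ.* p ℕ.* (t ℕ.* t) ℕ.+ 3 ℕ.* (d ℕ.* d)

    module Regime (n w : ℕ) (1≤p : 1 ℕ.≤ p) (1≤k : 1 ℕ.≤ k) (1≤d : 1 ℕ.≤ d) (1≤n : 1 ℕ.≤ n) (N≤n : threshold ℕ.≤ n)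
      (range : (w ℕ.* 2) ℕ.* (w ℕ.* 2) ℕ.* (k ℕ.* k) ℕ.≤ p ℕ.* p ℕ.* n) where

      3d²≤n : 3 ℕ.* (d ℕ.* d) ℕ.≤ n
      3d²≤n = ℕ.≤-trans (ℕ.m≤n+m _ (k ℕ.* k ℕ.+ p ℕ.* p ℕ.* (t ℕ.* t))) N≤n

      k²≤n : k ℕ.* k ℕ.≤ n
      k²≤n = ℕ.≤-trans (ℕ.≤-trans (ℕ.m≤m+n (k ℕ.* k) (p ℕ.* p ℕ.* (t ℕ.* t))) (ℕ.m≤m+n _ (3 ℕ.* (d ℕ.* d)))) N≤n

      p²t²≤n : p ℕ.* p ℕ.* (t ℕ.* t) ℕ.≤ n
      p²t²≤n = ℕ.≤-trans (ℕ.≤-trans (ℕ.m≤n+m (p ℕ.* p ℕ.* (t ℕ.* t)) (k ℕ.* k)) (ℕ.m≤m+n _ (3 ℕ.* (d ℕ.* d)))) N≤n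

      -- Since w² ≤ p²n, one gets (tw)² ≤ p²t²n ≤ n²: a bound of order √n beats any fixed multiple
      -- once `n` is large.
      tw≤n : t ℕ.* w ℕ.≤ n
      tw≤n = square-cancel-≤ (begin
        t ℕ.* w ℕ.* (t ℕ.* w)                                  ≡⟨ regroup t w ⟩
        t ℕ.* t ℕ.* (w ℕ.* w ℕ.* (1 ℕ.* 1))                    ≤⟨ ℕ.*-monoʳ-≤ (t ℕ.* t) (ℕ.*-mono-≤ (square-mono-≤ (ℕ.m≤m*n w 2)) (square-mono-≤ 1≤k)) ⟩
        t ℕ.* t ℕ.* ((w ℕ.* 2) ℕ.* (w ℕ.* 2) ℕ.* (k ℕ.* k))    ≤⟨ ℕ.*-monoʳ-≤ (t ℕ.* t) range ⟩
        t ℕ.* t ℕ.* (p ℕ.* p ℕ.* n)                            ≡⟨ swap (t ℕ.* t) (p ℕ.* p) n ⟩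
        p ℕ.* p ℕ.* (t ℕ.* t) ℕ.* n                            ≤⟨ ℕ.*-monoˡ-≤ n p²t²≤n ⟩
        n ℕ.* n                                                ∎)
        where
        open ℕ.≤-Reasoning
        regroup : ∀ t w → t ℕ.* w ℕ.* (t ℕ.* w) ≡ t ℕ.* t ℕ.* (w ℕ.* w ℕ.* (1 ℕ.* 1))
        regroup = ℕ-Solver.solve-∀
        swap : ∀ t p n → t ℕ.* (p ℕ.* n) ≡ p ℕ.* t ℕ.* n
        swap = ℕ-Solver.solve-∀

      1+w≤n : suc w ℕ.≤ n
      1+w≤n = go w tw≤n
        where
        go : ∀ w → t ℕ.* w ℕ.≤ n → suc w ℕ.≤ n
        go zero    _    = 1≤n
        go (suc v) tw≤n = ℕ.≤-trans (ℕ.+-mono-≤ (ℕ.s≤s ℕ.z≤n) (ℕ.m≤m+n (suc v) 0)) (ℕ.≤-trans (ℕ.*-monoˡ-≤ (suc v) 2≤t) tw≤n)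
          where
          2≤t : 2 ℕ.≤ t
          2≤t = ℕ.+-monoˡ-≤ 1 (ℕ.≤-trans (ℕ.*-mono-≤ 1≤d 1≤d) (ℕ.m≤n*m (d ℕ.* d) 16))

      -- The central `x` has |x| ≤ 1 + w, whereas the range of z controls 2w. For w ≥ 1 this
      -- suffices, as 1 + w ≤ 2w; for w = 0 it is k² ≤ n ≤ p²n.
      [1+w]²-in-range : suc w ℕ.* suc w ℕ.* (k ℕ.* k) ℕ.≤ p ℕ.* p ℕ.* n
      [1+w]²-in-range = go w range
        where
        go : ∀ w → (w ℕ.* 2) ℕ.* (w ℕ.* 2) ℕ.* (k ℕ.* k) ℕ.≤ p ℕ.* p ℕ.* n → suc w ℕ.* suc w ℕ.* (k ℕ.* k) ℕ.≤ p ℕ.* p ℕ.* n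
        go zero    _ = ℕ.≤-trans (ℕ.≤-reflexive (ℕ.*-identityˡ (k ℕ.* k))) (ℕ.≤-trans k²≤n (ℕ.m≤n*m n (p ℕ.* p) {{ℕ.>-nonZero (ℕ.*-mono-≤ 1≤p 1≤p)}}))
        go (suc v) r = ℕ.≤-trans (ℕ.*-monoˡ-≤ (k ℕ.* k) (square-mono-≤ (ℕ.s≤s (ℕ.s≤s (ℕ.m≤m*n v 2))))) r

  closeToSqrt2 : ∀ c ε p k e d → 0ℚ < c → 0ℚ < ε → 1 ℕ.≤ p → 1 ℕ.≤ k → 1 ℕ.≤ e → 1 ℕ.≤ d →
    c * ι k ≡ ι p → ε * ι d ≡ ι e →
    ∀ n → 1 ℕ.≤ n → Threshold.threshold p k d ℕ.≤ n →
    ∀ z → (+ 2) ∣ z → InRange c n z → CloseToSqrt2 (maxRatio c n z) ε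
  closeToSqrt2 c ε p k e d 0<c 0<ε 1≤p 1≤k 1≤e 1≤d ck≡p εd≡e n 1≤n N≤n z 2∣z z∈ =
    let w , ±z = double z 2∣z in Conclusion.by-sign w (∣double∣ w ±z) ±z
    where
    module Conclusion (w : ℕ) (∣z∣≡2w : ℤ.∣ z ∣ ≡ w ℕ.* 2) where
      instance
        k≢0 : ℕ.NonZero k
        k≢0 = ℕ.>-nonZero 1≤k
      range : (w ℕ.* 2) ℕ.* (w ℕ.* 2) ℕ.* (k ℕ.* k) ℕ.≤ p ℕ.* p ℕ.* n
      range = subst (λ m → m ℕ.* m ℕ.* (k ℕ.* k) ℕ.≤ p ℕ.* p ℕ.* n) ∣z∣≡2w (InRange⇒ c p k ck≡p n z z∈)
      open Threshold.Regime p k d n w 1≤p 1≤k 1≤d 1≤n N≤n range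
      w≤n : w ℕ.≤ n
      w≤n = ℕ.≤-trans (ℕ.n≤1+n w) 1+w≤n
      open Centre w≤n

      -- The sign of z enters only through the arguments. `classify` serves every entry of the
      -- maximum for the upper half, while `x` with its parametrisation is the single witness for
      -- the lower half.
      conclude : ∀ x m → fBinomial n z ≡ (2 ℕ.* n) C (n ℕ.+ w) →
        (∀ y j → + n ℤ.- y ≡ j ℤ.* + 2 → Classified n w z y) →
        + n ℤ.- x ≡ + m ℤ.* + 2 → ℤ.∣ x ∣ ℕ.≤ suc w → Parametrised n w a z x →
        CloseToSqrt2 (maxRatio c n z) ε
      conclude x m D≡ classify n-x ∣x∣≤1+w param = below , above
        where
        below : BelowSqrt2+ (maxRatio c n z) ε
        below = foldr-⊔-preserves (ratio n z) (λ q → BelowSqrt2+ q ε)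
          (0-below-√2+ε n w z ε e d 1≤n w≤n D≡ 0<ε 1≤e 1≤d εd≡e) (admissible c n) (λ {y} y∈ →
            ratio-below n w z ε e d 1≤n w≤n D≡ 0<ε 1≤e 1≤d εd≡e y tw≤n
              (classify y ((+ n ℤ.- y) /ℕ 2) (SameParity⇒double n y (∈-admissible⇒SameParity c n y∈))))
        x∈ : x ∈ admissible c n
        x∈ = ∈-admissible c n x 0<c
          (InRange⇐ c p k ck≡p n x (ℕ.≤-trans (ℕ.*-monoˡ-≤ (k ℕ.* k) (square-mono-≤ ∣x∣≤1+w)) [1+w]²-in-range))
          (double⇒SameParity n x m n-x) (ℕ.≤-trans ∣x∣≤1+w 1+w≤n)
        bounds = ratio-above n w z ε e d 1≤n w≤n D≡ 0<ε 1≤e 1≤d εd≡e x a b 3d²≤n param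
          a+b+w≡n a≤1+b b≤1+a a+⌊w/2⌋≡⌊n/2⌋
        above = above-√2-ε (ratio n z x) (maxRatio c n z) ε 0<ε (proj₁ bounds)
          (≤-foldr-⊔ (ratio n z) (admissible c n) x∈) (proj₂ bounds)

      by-sign : z ≡ + w ℤ.* + 2 ⊎ z ≡ ℤ.- (+ w ℤ.* + 2) → CloseToSqrt2 (maxRatio c n z) ε
      by-sign (inj₁ z≡) = conclude x⁺ a
        (trans (cong (fBinomial n) z≡) (Nonnegative-z.denominator n w x⁺ w≤n))
        (λ y → subst (λ z → ∀ j → + n ℤ.- y ≡ j ℤ.* + 2 → Classified n w z y) (sym z≡) (Nonnegative-z.classify n w y))
        n-x⁺ ∣x⁺∣≤1+w
        (subst (λ z → Parametrised n w a z x⁺) (sym z≡) (Nonnegative-z.parametrised n w x⁺ a n-x⁺ a+w≤n))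
      by-sign (inj₂ z≡) = conclude x⁻ (a ℕ.+ w)
        (trans (cong (fBinomial n) z≡) (Nonpositive-z.denominator n w x⁻))
        (λ y → subst (λ z → ∀ j → + n ℤ.- y ≡ j ℤ.* + 2 → Classified n w z y) (sym z≡) (Nonpositive-z.classify n w y))
        n-x⁻ ∣x⁻∣≤1+w
        (subst (λ z → Parametrised n w a z x⁻) (sym z≡) (Nonpositive-z.parametrised n w x⁻ a n-x⁻ (ℕ.≤-trans (ℕ.m≤m+n a w) a+w≤n)))

open import Defs
open import Data.Nat using (ℕ; _≤_)
open import Data.Integer using (ℤ; +_; _*_)
open import Data.Integer.Divisibility using (_∣_)
open import Data.Rational using (ℚ; 0ℚ; _<_)
open import Data.Product using (∃-syntax; _,_)
open RationalBounds using (positive-fraction)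
open RatioLimit using (closeToSqrt2; module Threshold)

theorem7 : (c : ℚ) → 0ℚ < c → (ε : ℚ) → 0ℚ < ε →
    ∃[ N ] ((n : ℕ) → 1 ≤ n → N ≤ n →
    (z : ℤ) → (+ 2) ∣ z → InRange c n z →
    CloseToSqrt2 (maxRatio c n z) ε)
theorem7 c 0<c ε 0<ε =
  let p , k , 1≤p , 1≤k , ck≡p = positive-fraction c 0<c
      e , d , 1≤e , 1≤d , εd≡e = positive-fraction ε 0<ε
  in Threshold.threshold p k d ,
     closeToSqrt2 c ε p k e d 0<c 0<ε 1≤p 1≤k 1≤e 1≤d ck≡p εd≡e
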